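{- The $\mathbb{Q}$-linear map $\mathcal{H}_{\mathrm{Des}} \to \mathrm{QSym}$ defined by $[\pi]_{\mathrm{Des}} \mapsto F_{\mathrm{Comp}(\pi)}$ is an isomorphism of Hopf algebras.
   Context: A permutation is a finite (possibly empty) sequence $\pi = \pi_1 \cdots \pi_n$ of distinct positive integers, called its letters; $|\pi| = n$ is its length. $\mathrm{Des}(\pi) = \{1 \le i \le n-1 : \pi_i > \pi_{i+1}\}$ is the descent set. Write $\pi \sim_{\mathrm{Des}} \sigma$ if $|\pi| = |\sigma|$ and $\mathrm{Des}(\pi) = \mathrm{Des}(\sigma)$; $[\pi]_{\mathrm{Des}}$ is the equivalence class of $\pi$. For permutations with no letters in common, the shuffle set $\pi ⧢ \sigma$ is the set of all $\binom{|\pi|+|\sigma|}{|\pi|}$ permutations of length $|\pi|+|\sigma|$ containing both $\pi$ and $\sigma$ as subsequences. It is known that $\mathrm{Des}$ is shuffle-compatible (for disjoint $\pi,\sigma$ the multiset $\{\mathrm{Des}(\tau):\tau\in\pi⧢\sigma\}$ depends only on the descent sets and lengths of $\pi$ and $\sigma$) and substring-compatible (the descent set and length of $\pi$ determine the descent set of every substring $\pi_i\cdots\pi_j$). $\mathcal{H}_{\mathrm{Des}}$ is the graded connected Hopf algebra over $\mathbb{Q}$ with basis the classes $[\pi]_{\mathrm{Des}}$, graded by length, product $[\pi]_{\mathrm{Des}} \cdot [\sigma]_{\mathrm{Des}} = \sum_{\tau \in \pi ⧢ \sigma} [\tau]_{\mathrm{Des}}$ for disjoint representatives $\pi,\sigma$,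 unit the class of the empty permutation, coproduct $\Delta([\pi]_{\mathrm{Des}}) = \sum_{i=0}^{n} [\pi_1 \cdots \pi_i]_{\mathrm{Des}} \otimes [\pi_{i+1} \cdots \pi_n]_{\mathrm{Des}}$, and counit sending the class of the empty permutation to $1$ and all other classes to $0$ (the antipode exists uniquely because the bialgebra is graded and connected). If $\mathrm{Des}(\pi) = \{d_1 < \cdots < d_k\}$ with $|\pi|=n\ge1$, then $\mathrm{Comp}(\pi) = (d_1, d_2 - d_1, \dots, d_k - d_{k-1}, n - d_k)$ (equal to $(n)$ if there are no descents); $\mathrm{Comp}$ of the empty permutation is the empty composition. $\mathrm{QSym}$ is the Hopf algebra of quasisymmetric functions over $\mathbb{Q}$ with its usual structure, and $\{F_\alpha\}$, indexed by integer compositions, is its fundamental basis: for $\alpha = (\alpha_1,\dots,\alpha_\ell)$ a composition of $n$, $F_\alpha = \sum x_{i_1} \cdots x_{i_n}$ over all $i_1 \le \cdots \le i_n$ with $i_j < i_{j+1}$ whenever $j \in \{\alpha_1, \alpha_1+\alpha_2, \dots, \alpha_1+\cdots+\alpha_{\ell-1}\}$; $F_\varnothing = 1$. -}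

module Defs where

open import Level using (0ℓ)
open import Algebra.Module.Bundles.Raw using (RawLeftModule)
open import Algebra.Module.Morphism.Structures using (module LeftModuleMorphisms)
open import Data.Bool.Base using (if_then_else_)
open import Data.Empty using (⊥-elim)
open import Data.List.Base using (List; []; _∷_; _++_; map; concatMap; length; take; drop; replicate; upTo; foldr)
import Data.List.Properties as List
open import Data.List.Extrema.Nat using (max; xs≤max)
open import Data.List.Membership.Propositional using (_∈_)
open import Data.List.Membership.Propositional.Properties using (∈-map⁻)
open import Data.List.Relation.Binary.Disjoint.Propositional using (Disjoint)
open import Data.List.Relation.Binary.Permutation.Propositional using (_↭_; prep; ↭-refl; ↭-sym; ↭-trans; ↭-reflexive; ↭⇒↭ₛ)
open import Data.List.Relation.Binary.Permutation.Propositional.Properties using (All-resp-↭; shift)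
import Data.List.Relation.Binary.Permutation.Setoid.Properties as Permutation
open import Data.List.Relation.Unary.All as All using (All; []; _∷_)
import Data.List.Relation.Unary.All.Properties as All
open import Data.List.Relation.Unary.Unique.Propositional using (Unique; [])
import Data.List.Relation.Unary.Unique.Propositional.Properties as Unique
open import Data.Nat.Base as ℕ using (ℕ; zero; suc; _≤_; _<_; s≤s)
open import Data.Nat.ListAction using (sum)
import Data.Nat.Properties as ℕ
open import Data.Product.Base as Product using (_×_; _,_)
open import Data.Rational.Base as ℚ using (ℚ; 0ℚ; 1ℚ)
import Data.Rational.Properties as ℚ
open import Function.Base using (_∘_)
open import Relation.Binary.Core using (Rel)
open import Relation.Binary.Definitions using (Decidable)
open import Relation.Binary.PropositionalEquality.Core using (_≡_; refl; sym; trans; cong; cong₂; subst)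
open import Relation.Binary.PropositionalEquality.Properties using (setoid)
open import Relation.Nullary.Decidable using (Dec; yes; no; does; dec-true; dec-false; _×-dec_)
open import Relation.Nullary.Negation.Core using (¬_)
open import Data.List.Membership.DecPropositional ℕ._≟_ using (_∈?_)

------------------------------------------------------------------------
-- Hopf algebras over ℚ and their isomorphisms

ℚ-Mod : Set₁
ℚ-Mod = RawLeftModule ℚ 0ℓ 0ℓ

-- The tensor product M ⊗ N: finite sums of pure tensors (lists, with _++_ as
-- addition) modulo the congruence generated by ℚ-bilinearity.
module Tensor (M N : ℚ-Mod) where

  private
    module M = RawLeftModule M
    module N = RawLeftModule N

  Carrier : Set
  Carrier = List (M.Carrierᴹ × N.Carrierᴹ)

  infix 5 _⊗_
  _⊗_ : M.Carrierᴹ → N.Carrierᴹ → Carrier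
  m ⊗ n = (m , n) ∷ []

  infix 4 _≈_
  data _≈_ : Rel Carrier 0ℓ where
    ≈-refl   : ∀ {s} → s ≈ s
    ≈-sym    : ∀ {s t} → s ≈ t → t ≈ s
    ≈-trans  : ∀ {s t u} → s ≈ t → t ≈ u → s ≈ u
    ++-cong  : ∀ {s s′ t t′} → s ≈ s′ → t ≈ t′ → s ++ t ≈ s′ ++ t′
    ++-comm  : ∀ s t → s ++ t ≈ t ++ s
    ⊗-cong   : ∀ {m m′ n n′} → m M.≈ᴹ m′ → n N.≈ᴹ n′ → m ⊗ n ≈ m′ ⊗ n′
    distribʳ : ∀ m m′ n → (m M.+ᴹ m′) ⊗ n ≈ (m ⊗ n) ++ (m′ ⊗ n)
    distribˡ : ∀ m n n′ → m ⊗ (n N.+ᴹ n′) ≈ (m ⊗ n) ++ (m ⊗ n′)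
    zeroˡ    : ∀ n → M.0ᴹ ⊗ n ≈ []
    zeroʳ    : ∀ m → m ⊗ N.0ᴹ ≈ []
    balanced : ∀ q m n → (q M.*ₗ m) ⊗ n ≈ m ⊗ (q N.*ₗ n)

record RawHopfAlgebra : Set₁ where
  infixl 7 _*_
  field
    rawLeftModule : ℚ-Mod

  open RawLeftModule rawLeftModule public

  field
    _*_ : Carrierᴹ → Carrierᴹ → Carrierᴹ
    1#  : Carrierᴹ
    Δ   : Carrierᴹ → Tensor.Carrier rawLeftModule rawLeftModule
    ε   : Carrierᴹ → ℚ
    S   : Carrierᴹ → Carrierᴹ

module _ (A B : RawHopfAlgebra) where

  private
    module A = RawHopfAlgebra A
    module B = RawHopfAlgebra B
    module B⊗B = Tensor B.rawLeftModule B.rawLeftModule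
  open LeftModuleMorphisms A.rawLeftModule B.rawLeftModule using (IsLeftModuleIsomorphism)

  record IsHopfAlgebraIsomorphism (f : A.Carrierᴹ → B.Carrierᴹ) : Set where
    field
      isLeftModuleIsomorphism : IsLeftModuleIsomorphism f
      *-homo : ∀ x y → f (x A.* y) B.≈ᴹ f x B.* f y
      1-homo : f A.1# B.≈ᴹ B.1#
      Δ-homo : ∀ x → map (Product.map f f) (A.Δ x) B⊗B.≈ B.Δ (f x)
      ε-homo : ∀ x → A.ε x ≡ B.ε (f x)
      S-homo : ∀ x → f (A.S x) B.≈ᴹ B.S (f x)

------------------------------------------------------------------------
-- Permutations and descents

record Perm : Set where
  constructor perm
  field
    letters  : List ℕ
    positive : All (0 <_) letters
    distinct : Unique letters

open Perm public

∣_∣ : Perm → ℕ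
∣ π ∣ = length (letters π)

-- The increasing list of all positions i (counted from 1) with R wᵢ wᵢ₊₁.
positions : {R : Rel ℕ 0ℓ} → Decidable R → List ℕ → List ℕ
positions R? []          = []
positions R? (_ ∷ [])    = []
positions R? (x ∷ y ∷ w) =
  if does (R? x y)
  then 1 ∷ map suc (positions R? (y ∷ w))
  else map suc (positions R? (y ∷ w))

-- Des π is an increasing list, so sets of descents agree iff the lists do.
Des : Perm → List ℕ
Des π = positions ℕ._>?_ (letters π)

infix 4 _∼_ _∼?_
_∼_ : Rel Perm 0ℓ
π ∼ σ = ∣ π ∣ ≡ ∣ σ ∣ × Des π ≡ Des σ

_∼?_ : Decidable _∼_
π ∼? σ = (∣ π ∣ ℕ.≟ ∣ σ ∣) ×-dec List.≡-dec ℕ._≟_ (Des π) (Des σ)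

-- gaps p (d₁ ∷ … ∷ dₖ ∷ []) n = (d₁ - p , d₂ - d₁ , … , n - dₖ)
gaps : ℕ → List ℕ → ℕ → List ℕ
gaps p []       n = (n ℕ.∸ p) ∷ []
gaps p (d ∷ ds) n = (d ℕ.∸ p) ∷ gaps d ds n

Comp : Perm → List ℕ
Comp   (perm []      _ _) = []
Comp π@(perm (_ ∷ _) _ _) = gaps 0 (Des π) ∣ π ∣

∅ : Perm
∅ = perm [] [] []

prefix suffix : ℕ → Perm → Perm
prefix i (perm w p u) = perm (take i w) (All.take⁺ i p) (Unique.take⁺ i u)
suffix i (perm w p u) = perm (drop i w) (All.drop⁺ i p) (Unique.drop⁺ i u)

------------------------------------------------------------------------
-- Shuffles

shuffles : List ℕ → List ℕ → List (List ℕ)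
shuffles []       ys       = ys ∷ []
shuffles (x ∷ xs) []       = (x ∷ xs) ∷ []
shuffles (x ∷ xs) (y ∷ ys) =
  map (x ∷_) (shuffles xs (y ∷ ys)) ++ map (y ∷_) (shuffles (x ∷ xs) ys)

shuffles-↭ : ∀ xs ys → All (_↭ xs ++ ys) (shuffles xs ys)
shuffles-↭ []       ys       = ↭-refl ∷ []
shuffles-↭ (x ∷ xs) []       = ↭-reflexive (sym (List.++-identityʳ (x ∷ xs))) ∷ []
shuffles-↭ (x ∷ xs) (y ∷ ys) = All.++⁺
  (All.map⁺ (All.map (prep x) (shuffles-↭ xs (y ∷ ys))))
  (All.map⁺ (All.map (λ p → ↭-trans (prep y p) (↭-sym (shift y (x ∷ xs) ys)))
                     (shuffles-↭ (x ∷ xs) ys)))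

shuffle : (π σ : Perm) → Disjoint (letters π) (letters σ) → List Perm
shuffle π σ π#σ = All.reduce mk (shuffles-↭ (letters π) (letters σ))
  where
  mk : ∀ {τ} → τ ↭ letters π ++ letters σ → Perm
  mk {τ} p = perm τ
    (All-resp-↭ (↭-sym p) (All.++⁺ (positive π) (positive σ)))
    (Permutation.Unique-resp-↭ (setoid ℕ) (↭⇒↭ₛ (↭-sym p))
      (Unique.++⁺ (distinct π) (distinct σ) π#σ))

record DisjointRepresentatives (π σ : Perm) : Set where
  field
    π′ σ′    : Perm
    π′∼π     : π′ ∼ π
    σ′∼σ     : σ′ ∼ σ
    disjoint : Disjoint (letters π′) (letters σ′)

  shuffleSet : List Perm
  shuffleSet = shuffle π′ σ′ disjoint

-- A choice of the disjoint representatives used to multiply two classes.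
Representatives : Set
Representatives = ∀ π σ → DisjointRepresentatives π σ

------------------------------------------------------------------------
-- The Hopf algebra of descent classes

-- Formal ℚ-linear combinations of permutations; two are identified when every
-- class [ σ ] has the same total coefficient in both, so this is the free
-- ℚ-module on the classes.
HCarrier : Set
HCarrier = List (ℚ × Perm)

[_] : Perm → HCarrier
[ π ] = (1ℚ , π) ∷ []

coefficient : HCarrier → Perm → ℚ
coefficient []            σ = 0ℚ
coefficient ((q , π) ∷ x) σ =
  (if does (π ∼? σ) then q else 0ℚ) ℚ.+ coefficient x σ

scaleᴴ : ℚ → HCarrier → HCarrier
scaleᴴ q = map (Product.map₁ (q ℚ.*_))

H-Module : ℚ-Mod
H-Module = record
  { Carrierᴹ = HCarrier
  ; _≈ᴹ_     = λ x y → ∀ σ → coefficient x σ ≡ coefficient y σ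
  ; _+ᴹ_     = _++_
  ; _*ₗ_     = scaleᴴ
  ; 0ᴹ       = []
  ; -ᴹ_      = map (Product.map₁ (ℚ.-_))
  }

Δᴴ : HCarrier → Tensor.Carrier H-Module H-Module
Δᴴ = concatMap λ (q , π) →
  map (λ i → scaleᴴ q [ prefix i π ] , [ suffix i π ]) (upTo (suc ∣ π ∣))

module _ (reps : Representatives) where

  private
    module H = RawLeftModule H-Module

  mulᴴ : HCarrier → HCarrier → HCarrier
  mulᴴ x y =
    concatMap (λ (q , π) → concatMap (λ (r , σ) →
      map (q ℚ.* r ,_) (DisjointRepresentatives.shuffleSet (reps π σ))) y) x

  -- The antipode of a graded connected bialgebra is determined by
  -- S [ ∅ ] = [ ∅ ] and  S [ π ] = - Σ_{i<n} S [ π₁⋯πᵢ ] · [ πᵢ₊₁⋯πₙ ]  for n ≥ 1.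
  -- The first argument is fuel, sufficient when it is at least ∣ π ∣.
  antipodeᴴ : ℕ → Perm → HCarrier
  antipodeᴴ _         (perm []      _ _) = [ ∅ ]
  antipodeᴴ zero      (perm (_ ∷ _) _ _) = []
  antipodeᴴ (suc k) π@(perm (_ ∷ _) _ _) = H.-ᴹ
    concatMap (λ i → mulᴴ (antipodeᴴ k (prefix i π)) [ suffix i π ]) (upTo ∣ π ∣)

  H-Des : RawHopfAlgebra
  H-Des = record
    { rawLeftModule = H-Module
    ; _*_ = mulᴴ
    ; 1#  = [ ∅ ]
    ; Δ   = Δᴴ
    ; ε   = λ x → coefficient x ∅
    ; S   = concatMap λ (q , π) → scaleᴴ q (antipodeᴴ ∣ π ∣ π)
    }

------------------------------------------------------------------------
-- Disjoint representatives exist: shift the letters of σ past those of π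

positions-map-+ : ∀ {R : Rel ℕ 0ℓ} (R? : Decidable R) k →
  (∀ x y → does (R? (k ℕ.+ x) (k ℕ.+ y)) ≡ does (R? x y)) →
  ∀ w → positions R? (map (k ℕ.+_) w) ≡ positions R? w
positions-map-+ R? k inv []          = refl
positions-map-+ R? k inv (_ ∷ [])    = refl
positions-map-+ R? k inv (x ∷ y ∷ w) =
  cong₂ (λ b is → if b then 1 ∷ map suc is else map suc is)
    (inv x y) (positions-map-+ R? k inv (y ∷ w))

does-<?-+ : ∀ k x y → does ((k ℕ.+ x) ℕ.<? (k ℕ.+ y)) ≡ does (x ℕ.<? y)
does-<?-+ zero    x y = refl
does-<?-+ (suc k) x y = does-<?-+ k x y

standardRepresentatives : Representatives
standardRepresentatives π σ = record
  { π′       = π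
  ; σ′       = perm (map (k ℕ.+_) (letters σ))
                 (All.map⁺ (All.map (λ {x} 0<x → ℕ.≤-trans 0<x (ℕ.m≤n+m x k)) (positive σ)))
                 (Unique.map⁺ (ℕ.+-cancelˡ-≡ k _ _) (distinct σ))
  ; π′∼π     = refl , refl
  ; σ′∼σ     = List.length-map (k ℕ.+_) (letters σ)
             , positions-map-+ ℕ._>?_ k (λ x y → does-<?-+ k y x) (letters σ)
  ; disjoint = disj
  }
  where
  k : ℕ
  k = max 0 (letters π)
  disj : Disjoint (letters π) (map (k ℕ.+_) (letters σ))
  disj (v∈π , v∈σ′) with ∈-map⁻ (k ℕ.+_) v∈σ′
  ... | x , x∈σ , refl = ℕ.<⇒≱
    (ℕ.m<m+n k (All.lookup (positive σ) x∈σ))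
    (All.lookup (xs≤max 0 (letters π)) v∈π)

------------------------------------------------------------------------
-- Quasisymmetric functions

-- The list (a₁ , … , aₘ) stands for the monomial x₁^a₁ ⋯ xₘ^aₘ; lists that
-- differ only by trailing zeros stand for the same monomial.
Monomial : Set
Monomial = List ℕ

nonzeroExponents : Monomial → List ℕ
nonzeroExponents []          = []
nonzeroExponents (zero  ∷ a) = nonzeroExponents a
nonzeroExponents (suc n ∷ a) = suc n ∷ nonzeroExponents a

-- x_{i₁}^α₁ ⋯ x_{iₖ}^αₖ and x_{j₁}^α₁ ⋯ x_{jₖ}^αₖ (i and j increasing) have equal
-- coefficients.  In particular f ignores trailing zeros, so that f really is
-- a formal power series.
IsQuasisymmetric : (Monomial → ℚ) → Set
IsQuasisymmetric f = ∀ a b → nonzeroExponents a ≡ nonzeroExponents b → f a ≡ f b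

record QSymCarrier : Set where
  field
    coeff          : Monomial → ℚ
    degree         : ℕ
    bounded        : ∀ a → degree < sum a → coeff a ≡ 0ℚ
    quasisymmetric : IsQuasisymmetric coeff

open QSymCarrier public

QSym-Module : ℚ-Mod
QSym-Module = record
  { Carrierᴹ = QSymCarrier
  ; _≈ᴹ_     = λ f g → ∀ a → coeff f a ≡ coeff g a
  ; _+ᴹ_     = λ f g → record
    { coeff          = λ a → coeff f a ℚ.+ coeff g a
    ; degree         = degree f ℕ.⊔ degree g
    ; bounded        = λ a d< → cong₂ ℚ._+_
        (bounded f a (ℕ.≤-<-trans (ℕ.m≤m⊔n (degree f) (degree g)) d<))
        (bounded g a (ℕ.≤-<-trans (ℕ.m≤n⊔m (degree f) (degree g)) d<))
    ; quasisymmetric = λ a b eq → cong₂ ℚ._+_ (quasisymmetric f a b eq) (quasisymmetric g a b eq)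
    }
  ; _*ₗ_     = λ q f → record
    { coeff          = λ a → q ℚ.* coeff f a
    ; degree         = degree f
    ; bounded        = λ a d< → trans (cong (q ℚ.*_) (bounded f a d<)) (ℚ.*-zeroʳ q)
    ; quasisymmetric = λ a b eq → cong (q ℚ.*_) (quasisymmetric f a b eq)
    }
  ; 0ᴹ       = record
    { coeff          = λ _ → 0ℚ
    ; degree         = 0
    ; bounded        = λ _ _ → refl
    ; quasisymmetric = λ _ _ _ → refl
    }
  ; -ᴹ_      = λ f → record
    { coeff          = λ a → ℚ.- coeff f a
    ; degree         = degree f
    ; bounded        = λ a d< → cong ℚ.-_ (bounded f a d<)
    ; quasisymmetric = λ a b eq → cong ℚ.-_ (quasisymmetric f a b eq)
    }
  }

module QSymᴹ = RawLeftModule QSym-Module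

sumᵠ : List QSymCarrier → QSymCarrier
sumᵠ = foldr QSymᴹ._+ᴹ_ QSymᴹ.0ᴹ

------------------------------------------------------------------------
-- The product of power series

factorisations : Monomial → List (Monomial × Monomial)
factorisations []      = ([] , []) ∷ []
factorisations (n ∷ a) =
  concatMap (λ i → map (Product.map (i ∷_) ((n ℕ.∸ i) ∷_)) (factorisations a)) (upTo (suc n))

∑ : {A : Set} → List A → (A → ℚ) → ℚ
∑ []       f = 0ℚ
∑ (x ∷ xs) f = f x ℚ.+ ∑ xs f

mulCoeff : (f g : Monomial → ℚ) → Monomial → ℚ
mulCoeff f g a = ∑ (factorisations a) λ (b , c) → f b ℚ.* g c

∑-cong : {A : Set} (xs : List A) {f g : A → ℚ} → (∀ x → f x ≡ g x) → ∑ xs f ≡ ∑ xs g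
∑-cong []       f≗g = refl
∑-cong (x ∷ xs) f≗g = cong₂ ℚ._+_ (f≗g x) (∑-cong xs f≗g)

∑-++ : {A : Set} (xs ys : List A) {f : A → ℚ} → ∑ (xs ++ ys) f ≡ ∑ xs f ℚ.+ ∑ ys f
∑-++ []       ys {f} = sym (ℚ.+-identityˡ (∑ ys f))
∑-++ (x ∷ xs) ys {f} =
  trans (cong (f x ℚ.+_) (∑-++ xs ys)) (sym (ℚ.+-assoc (f x) (∑ xs f) (∑ ys f)))

∑-map : {A B : Set} (h : A → B) (xs : List A) {f : B → ℚ} → ∑ (map h xs) f ≡ ∑ xs (f ∘ h)
∑-map h []           = refl
∑-map h (x ∷ xs) {f} = cong (f (h x) ℚ.+_) (∑-map h xs)

∑-concatMap : {A B : Set} (h : A → List B) (xs : List A) {f : B → ℚ} →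
  ∑ (concatMap h xs) f ≡ ∑ xs (λ x → ∑ (h x) f)
∑-concatMap h []           = refl
∑-concatMap h (x ∷ xs) {f} =
  trans (∑-++ (h x) (concatMap h xs)) (cong (∑ (h x) f ℚ.+_) (∑-concatMap h xs))

∑-zero : {A : Set} {xs : List A} {f : A → ℚ} → All (λ x → f x ≡ 0ℚ) xs → ∑ xs f ≡ 0ℚ
∑-zero []         = refl
∑-zero (eq ∷ eqs) = cong₂ ℚ._+_ eq (∑-zero eqs)

mulCoeff-∷ : ∀ f g n a → mulCoeff f g (n ∷ a) ≡
  ∑ (upTo (suc n)) (λ i → mulCoeff (f ∘ (i ∷_)) (g ∘ ((n ℕ.∸ i) ∷_)) a)
mulCoeff-∷ f g n a = trans
  (∑-concatMap (λ i → map (Product.map (i ∷_) ((n ℕ.∸ i) ∷_)) (factorisations a)) (upTo (suc n)))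
  (∑-cong (upTo (suc n)) λ i → ∑-map (Product.map (i ∷_) ((n ℕ.∸ i) ∷_)) (factorisations a))

∷-quasisymmetric : ∀ {f} i → IsQuasisymmetric f → IsQuasisymmetric (f ∘ (i ∷_))
∷-quasisymmetric zero    qs a b eq = qs (0 ∷ a) (0 ∷ b) eq
∷-quasisymmetric (suc i) qs a b eq = qs (suc i ∷ a) (suc i ∷ b) (cong (suc i ∷_) eq)

mulCoeff-nonzero : ∀ {f g} → IsQuasisymmetric f → IsQuasisymmetric g →
  ∀ a → mulCoeff f g a ≡ mulCoeff f g (nonzeroExponents a)
mulCoeff-nonzero qf qg [] = refl
mulCoeff-nonzero {f} {g} qf qg (zero ∷ a) =
  trans (mulCoeff-∷ f g 0 a)
  (trans (ℚ.+-identityʳ _)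
  (trans (∑-cong (factorisations a) λ (b , c) →
            cong₂ ℚ._*_ (qf (0 ∷ b) b refl) (qg (0 ∷ c) c refl))
         (mulCoeff-nonzero qf qg a)))
mulCoeff-nonzero {f} {g} qf qg (suc n ∷ a) =
  trans (mulCoeff-∷ f g (suc n) a)
  (trans (∑-cong (upTo (suc (suc n))) λ i →
            mulCoeff-nonzero (∷-quasisymmetric i qf) (∷-quasisymmetric (suc n ℕ.∸ i) qg) a)
         (sym (mulCoeff-∷ f g (suc n) (nonzeroExponents a))))

sum-nonzero : ∀ a → sum (nonzeroExponents a) ≡ sum a
sum-nonzero []          = refl
sum-nonzero (zero  ∷ a) = sum-nonzero a
sum-nonzero (suc n ∷ a) = cong (suc n ℕ.+_) (sum-nonzero a)

factorisations-sum : ∀ a → All (λ (b , c) → sum b ℕ.+ sum c ≡ sum a) (factorisations a)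
factorisations-sum []      = refl ∷ []
factorisations-sum (n ∷ a) =
  All.concat⁺ (All.map⁺ (All.applyUpTo⁺₁ (λ i → i) (suc n) step))
  where
  interchange : ∀ i j s t → (i ℕ.+ s) ℕ.+ (j ℕ.+ t) ≡ (i ℕ.+ j) ℕ.+ (s ℕ.+ t)
  interchange i j s t = trans (ℕ.+-assoc i s (j ℕ.+ t))
    (trans (cong (i ℕ.+_) (trans (sym (ℕ.+-assoc s j t))
      (trans (cong (ℕ._+ t) (ℕ.+-comm s j)) (ℕ.+-assoc j s t))))
      (sym (ℕ.+-assoc i j (s ℕ.+ t))))
  step : ∀ {i} → i < suc n → All (λ (b , c) → sum b ℕ.+ sum c ≡ n ℕ.+ sum a)
    (map (Product.map (i ∷_) ((n ℕ.∸ i) ∷_)) (factorisations a))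
  step {i} (s≤s i≤n) = All.map⁺ (All.map
    (λ {(b , c)} eq → trans (interchange i (n ℕ.∸ i) (sum b) (sum c))
      (cong₂ ℕ._+_ (ℕ.m+[n∸m]≡n i≤n) eq))
    (factorisations-sum a))

infixl 7 _*ᵠ_
_*ᵠ_ : QSymCarrier → QSymCarrier → QSymCarrier
f *ᵠ g = record
  { coeff          = mulCoeff (coeff f) (coeff g)
  ; degree         = degree f ℕ.+ degree g
  ; bounded        = λ a d< → ∑-zero (All.map (vanish a d<) (factorisations-sum a))
  ; quasisymmetric = λ a b eq →
      trans (mulCoeff-nonzero (quasisymmetric f) (quasisymmetric g) a)
      (trans (cong (mulCoeff (coeff f) (coeff g)) eq)
             (sym (mulCoeff-nonzero (quasisymmetric f) (quasisymmetric g) b)))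
  }
  where
  vanish : ∀ a → degree f ℕ.+ degree g < sum a →
    ∀ {(b , c) : Monomial × Monomial} → sum b ℕ.+ sum c ≡ sum a → coeff f b ℚ.* coeff g c ≡ 0ℚ
  vanish a d< {b , c} eq with sum b ℕ.≤? degree f | sum c ℕ.≤? degree g
  ... | no  b≰ | _      = trans (cong (ℚ._* coeff g c) (bounded f b (ℕ.≰⇒> b≰))) (ℚ.*-zeroˡ (coeff g c))
  ... | yes _  | no c≰  = trans (cong (coeff f b ℚ.*_) (bounded g c (ℕ.≰⇒> c≰))) (ℚ.*-zeroʳ (coeff f b))
  ... | yes b≤ | yes c≤ = ⊥-elim (ℕ.<⇒≱ d< (subst (_≤ degree f ℕ.+ degree g) eq (ℕ.+-mono-≤ b≤ c≤)))

------------------------------------------------------------------------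
-- The monomial and fundamental bases
--
-- Compositions are lists of positive integers; lists with a zero entry also
-- index M and F below, but only compositions are ever used as indices.

indicator : {P : Set} → Dec P → ℚ
indicator P? = if does P? then 1ℚ else 0ℚ

indicator-no : {P : Set} (P? : Dec P) → ¬ P → indicator P? ≡ 0ℚ
indicator-no (yes p) ¬p = ⊥-elim (¬p p)
indicator-no (no _)  ¬p = refl

-- M_α = Σ_{i₁<⋯<iₗ} x_{i₁}^α₁ ⋯ x_{iₗ}^αₗ
M : List ℕ → QSymCarrier
M α = record
  { coeff          = λ a → indicator (List.≡-dec ℕ._≟_ (nonzeroExponents a) α)
  ; degree         = sum α
  ; bounded        = λ a d< → indicator-no (List.≡-dec ℕ._≟_ (nonzeroExponents a) α)
      λ eq → ℕ.<-irrefl (trans (sym (cong sum eq)) (sum-nonzero a)) d<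
  ; quasisymmetric = λ a b eq → cong (λ c → indicator (List.≡-dec ℕ._≟_ c α)) eq
  }

-- partialSums α = (α₁ , α₁ + α₂ , … , α₁ + ⋯ + αₗ₋₁)
partialSums : List ℕ → List ℕ
partialSums []          = []
partialSums (_ ∷ [])    = []
partialSums (n ∷ m ∷ α) = n ∷ map (n ℕ.+_) (partialSums (m ∷ α))

-- indices 1 a is the unique sequence i₁ ≤ ⋯ ≤ iₙ with x_{i₁} ⋯ x_{iₙ} = xᵃ.
indices : ℕ → Monomial → List ℕ
indices k []      = []
indices k (n ∷ a) = replicate n k ++ indices (suc k) a

strictAscents : List ℕ → List ℕ
strictAscents = positions ℕ._<?_

indices-suc : ∀ k a → indices (suc k) a ≡ map suc (indices k a)
indices-suc k []      = refl
indices-suc k (n ∷ a) = trans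
  (cong₂ _++_ (sym (List.map-replicate suc n k)) (indices-suc (suc k) a))
  (sym (List.map-++ suc (replicate n k) (indices (suc k) a)))

indices-≥ : ∀ k a → All (k ≤_) (indices k a)
indices-≥ k []      = []
indices-≥ k (n ∷ a) = All.++⁺ (All.replicate⁺ n ℕ.≤-refl)
  (All.map (ℕ.≤-trans (ℕ.n≤1+n k)) (indices-≥ (suc k) a))

length-indices : ∀ k a → length (indices k a) ≡ sum a
length-indices k []      = refl
length-indices k (n ∷ a) = trans (List.length-++ (replicate n k))
  (cong₂ ℕ._+_ (List.length-replicate n) (length-indices (suc k) a))

strictAscents-replicate : ∀ n k v w → All (k <_) v → All (k <_) w →
  length v ≡ length w → strictAscents v ≡ strictAscents w →
  strictAscents (replicate (suc n) k ++ v) ≡ strictAscents (replicate (suc n) k ++ w)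
strictAscents-replicate zero k [] [] _ _ _ _ = refl
strictAscents-replicate zero k (x ∷ v) (y ∷ w) (k<x ∷ _) (k<y ∷ _) _ eq
  rewrite dec-true (k ℕ.<? x) k<x | dec-true (k ℕ.<? y) k<y | eq = refl
strictAscents-replicate (suc n) k v w k<v k<w len eq
  rewrite dec-false (k ℕ.<? k) (ℕ.<-irrefl refl) | strictAscents-replicate n k v w k<v k<w len eq = refl

strictAscents-nonzero : ∀ k a →
  strictAscents (indices k a) ≡ strictAscents (indices k (nonzeroExponents a))
strictAscents-nonzero k []          = refl
strictAscents-nonzero k (zero  ∷ a) = trans (cong strictAscents (indices-suc k a))
  (trans (positions-map-+ ℕ._<?_ 1 (does-<?-+ 1) (indices k a)) (strictAscents-nonzero k a))
strictAscents-nonzero k (suc n ∷ a) = strictAscents-replicate n k _ _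
  (indices-≥ (suc k) a) (indices-≥ (suc k) (nonzeroExponents a))
  (trans (length-indices (suc k) a)
    (trans (sym (sum-nonzero a)) (sym (length-indices (suc k) (nonzeroExponents a)))))
  (strictAscents-nonzero (suc k) a)

-- F_α is a sum of distinct monomials; xᵃ occurs in it iff its weakly increasing
-- index sequence i₁ ≤ ⋯ ≤ iₙ has length Σα and i_j < i_{j+1} for j in partialSums α.
occurs? : ∀ α n asc → Dec (n ≡ sum α × All (_∈ asc) (partialSums α))
occurs? α n asc = (n ℕ.≟ sum α) ×-dec All.all? (_∈? asc) (partialSums α)

F : List ℕ → QSymCarrier
F α = record
  { coeff          = λ a → indicator
      (occurs? α (length (indices 1 a)) (strictAscents (indices 1 a)))
  ; degree         = sum α
  ; bounded        = λ a d< → indicator-no (occurs? α _ _)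
      λ (eq , _) → ℕ.<-irrefl (trans (sym eq) (length-indices 1 a)) d<
  ; quasisymmetric = λ a b eq → cong₂ (λ n asc → indicator (occurs? α n asc))
      (trans (length-indices 1 a) (trans (sym (sum-nonzero a)) (trans (cong sum eq)
        (trans (sum-nonzero b) (sym (length-indices 1 b))))))
      (trans (strictAscents-nonzero 1 a) (trans (cong (strictAscents ∘ indices 1) eq)
        (sym (strictAscents-nonzero 1 b))))
  }

------------------------------------------------------------------------
-- The Hopf algebra QSym

incrementHead : List ℕ → List ℕ
incrementHead []      = []
incrementHead (n ∷ α) = suc n ∷ α

compositions : ℕ → List (List ℕ)
compositions zero          = [] ∷ []
compositions (suc zero)    = (1 ∷ []) ∷ []
compositions (suc (suc n)) =
  map (1 ∷_) (compositions (suc n)) ++ map incrementHead (compositions (suc n))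

-- f = Σ_α c_α M_α, where α runs over the compositions of 0, …, degree f and c_α
-- is the coefficient of x₁^α₁ ⋯ xₗ^αₗ in f.
monomialExpansion : QSymCarrier → List (ℚ × List ℕ)
monomialExpansion f =
  map (λ α → coeff f α , α) (concatMap compositions (upTo (suc (degree f))))

-- Δ M_α = Σ_{i=0}^ℓ M_(α₁,…,αᵢ) ⊗ M_(αᵢ₊₁,…,αₗ)
Δᵠ : QSymCarrier → Tensor.Carrier QSym-Module QSym-Module
Δᵠ f = concatMap
  (λ (c , α) → map (λ i → c QSymᴹ.*ₗ M (take i α) , M (drop i α)) (upTo (suc (length α))))
  (monomialExpansion f)

-- S M_∅ = 1 and  S M_α = - Σ_{i<ℓ} S M_(α₁,…,αᵢ) · M_(αᵢ₊₁,…,αₗ)  for ℓ ≥ 1.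
-- The first argument is fuel, sufficient when it is at least the length of α.
antipodeᵠ : ℕ → List ℕ → QSymCarrier
antipodeᵠ _       []        = M []
antipodeᵠ zero    (_ ∷ _)   = QSymᴹ.0ᴹ
antipodeᵠ (suc k) α@(_ ∷ _) = QSymᴹ.-ᴹ
  sumᵠ (map (λ i → antipodeᵠ k (take i α) *ᵠ M (drop i α)) (upTo (length α)))

QSym : RawHopfAlgebra
QSym = record
  { rawLeftModule = QSym-Module
  ; _*_ = _*ᵠ_
  ; 1#  = M []   -- the constant series 1
  ; Δ   = Δᵠ
  ; ε   = λ f → coeff f []
  ; S   = λ f → sumᵠ (map (λ (c , α) → c QSymᴹ.*ₗ antipodeᵠ (length α) α) (monomialExpansion f))
  }

-- The linear extension of [ π ] ↦ F_{Comp π}.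
Φ : HCarrier → QSymCarrier
Φ x = sumᵠ (map (λ (q , π) → q QSymᴹ.*ₗ F (Comp π)) x)

{-# OPTIONS --safe #-}

-- A word w with distinct letters has a fundamental function f_w: the coefficient
-- of x₁^a₁ ⋯ xₘ^aₘ is 1 if w is a concatenation of increasing words of lengths
-- a₁, …, aₘ, and 0 otherwise.  It depends only on the descents of w and equals F_{Comp w}.
-- Thus f_w (n ∷ a) = Σ_{w = uv} ζₙ(u) f_v (a), where ζₙ is the indicator of the
-- increasing words of length n, so w ↦ f_w is built from ζ by deconcatenation.
-- Two disjoint increasing words have exactly one increasing shuffle, and
-- deconcatenation is compatible with shuffling; hence products are preserved.
-- Coproducts are preserved because, on both sides, the coefficient of
-- x^β ⊗ x^γ is the coefficient at the concatenation βγ.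
-- Bijectivity is Möbius inversion between F_α = Σ_{β refines α} M_β and the
-- monomial basis, and the antipode of F_w obeys the recursion that defines it on
-- descent classes, since multiplication ∘ (S ⊗ id) ∘ Δ is unit ∘ counit on M_α.
module Submission where

open import Algebra.Bundles using (CommutativeMonoid)
open import Algebra.Module.Bundles.Raw using (RawLeftModule)
open import Algebra.Module.Morphism.Structures using (module LeftModuleMorphisms)
import Algebra.Properties.CommutativeSemigroup as CommutativeSemigroupProperties
open import Data.Bool.Base using (Bool; true; false; T; _∧_; _∨_; not; if_then_else_)
import Data.Bool.Properties as Bool
open import Data.Bool.Properties using (T?)
open import Data.Empty using (⊥-elim)
open import Data.List.Base using (List; []; _∷_; _++_; map; concatMap; length; null; take; drop; replicate; upTo; applyUpTo)
import Data.List.Properties as List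
open import Data.List.Membership.Propositional using (_∈_)
open import Data.List.Membership.Propositional.Properties using (∈-++⁺ˡ; ∈-++⁺ʳ; ∈-map⁺; ∈-map⁻)
open import Data.List.Relation.Unary.All as All using (All; []; _∷_)
import Data.List.Relation.Unary.All.Properties as All
open import Data.List.Relation.Unary.Any using (here; there)
open import Data.List.Relation.Binary.Disjoint.Propositional using (Disjoint)
open import Data.List.Relation.Binary.Permutation.Propositional.Properties using (↭-length)
open import Data.List.Relation.Unary.Unique.Propositional using (Unique; []; _∷_)
import Data.List.Relation.Unary.Unique.Propositional.Properties as Unique
open import Data.Maybe.Base using (Maybe; just; nothing)
import Data.Maybe.Properties as Maybe
open import Data.Nat.Base as ℕ using (ℕ; zero; suc; _≤_; _<_; s≤s; z≤n; _≡ᵇ_)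
open import Data.Nat.ListAction using (sum)
import Data.Nat.Properties as ℕ
open import Data.Product.Base as Product using (_×_; _,_; proj₁; ∃)
open import Data.Rational.Base using (ℚ; 0ℚ; 1ℚ; _+_; _*_; -_)
import Data.Rational.Properties as ℚ
open import Function.Base using (_∘_)
open import Function.Bundles using (mk⇔)
open import Level using (0ℓ)
open import Relation.Binary.Core using (Rel)
open import Relation.Binary.PropositionalEquality using (_≡_; _≢_; refl; sym; trans; cong; cong₂; subst; subst₂; module ≡-Reasoning)
open import Relation.Binary.Definitions using (Decidable; tri<; tri≈; tri>)
open import Relation.Nullary.Decidable using (Dec; does; yes; no; dec-true; dec-false; does-⇔)

open import Defs

open CommutativeSemigroupProperties (CommutativeMonoid.commutativeSemigroup ℚ.+-0-commutativeMonoid)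
  using () renaming (interchange to +-interchange)
open CommutativeSemigroupProperties (CommutativeMonoid.commutativeSemigroup ℚ.*-1-commutativeMonoid)
  using () renaming (interchange to *-interchange; x∙yz≈y∙xz to *-swap)

-- Finite sums

-- Shuffle identities need words with actual distinct letters, whereas both algebras only see
-- compositions. Bit strings (`Shape`) mediate: on them refinement is inclusion of marks, and the
-- Möbius function is that of a Boolean lattice. Two features of the setting shape the rest.
-- Equality in the tensor product is a generated congruence, so coefficients at pairs of monomials
-- decide it only once both tensors are rewritten to a common normal form; in the other direction,
-- multiplication after S ⊗ id must respect every generator before it can be applied to an equality
-- of coproducts. And `degree` is merely an upper bound carried by each representative, so equal
-- functions may be expanded over different ranges by the antipode of QSym; they are compared at a
-- common larger bound.

private
  variable
    A B : Set

∑-cong-All : {xs : List A} {f g : A → ℚ} → All (λ x → f x ≡ g x) xs → ∑ xs f ≡ ∑ xs g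
∑-cong-All []         = refl
∑-cong-All (eq ∷ eqs) = cong₂ _+_ eq (∑-cong-All eqs)

∑-0 : (xs : List A) → ∑ xs (λ _ → 0ℚ) ≡ 0ℚ
∑-0 xs = ∑-zero (All.universal (λ _ → refl) xs)

∑-+ : (xs : List A) (f g : A → ℚ) → ∑ xs (λ x → f x + g x) ≡ ∑ xs f + ∑ xs g
∑-+ []       f g = refl
∑-+ (x ∷ xs) f g = trans (cong (f x + g x +_) (∑-+ xs f g)) (+-interchange (f x) (g x) _ _)

*-∑ : (c : ℚ) (xs : List A) (f : A → ℚ) → c * ∑ xs f ≡ ∑ xs (λ x → c * f x)
*-∑ c []       f = ℚ.*-zeroʳ c
*-∑ c (x ∷ xs) f = trans (ℚ.*-distribˡ-+ c (f x) _) (cong (c * f x +_) (*-∑ c xs f))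

∑-* : (xs : List A) (f : A → ℚ) (c : ℚ) → ∑ xs f * c ≡ ∑ xs (λ x → f x * c)
∑-* xs f c = trans (ℚ.*-comm _ c) (trans (*-∑ c xs f) (∑-cong xs λ x → ℚ.*-comm c (f x)))

∑-neg : (xs : List A) (f : A → ℚ) → ∑ xs (λ x → - f x) ≡ - ∑ xs f
∑-neg []       f = refl
∑-neg (x ∷ xs) f = trans (cong (- f x +_) (∑-neg xs f)) (sym (ℚ.neg-distrib-+ (f x) _))

∑-swap : (xs : List A) (ys : List B) (f : A → B → ℚ) →
  ∑ xs (λ x → ∑ ys (f x)) ≡ ∑ ys (λ y → ∑ xs (λ x → f x y))
∑-swap []       ys f = sym (∑-0 ys)
∑-swap (x ∷ xs) ys f = trans (cong (∑ ys (f x) +_) (∑-swap xs ys f)) (sym (∑-+ ys (f x) _))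

∑-product : (xs : List A) (ys : List B) (f : A → ℚ) (g : B → ℚ) →
  ∑ xs (λ x → ∑ ys (λ y → f x * g y)) ≡ ∑ xs f * ∑ ys g
∑-product xs ys f g =
  trans (∑-cong xs λ x → sym (*-∑ (f x) ys g)) (sym (∑-* xs f (∑ ys g)))

∑-applyUpTo : (h : ℕ → A) (n : ℕ) (f : A → ℚ) → ∑ (applyUpTo h n) f ≡ ∑ (upTo n) (f ∘ h)
∑-applyUpTo h n f = trans (cong (λ xs → ∑ xs f) (sym (List.map-upTo h n))) (∑-map h (upTo n))

∑-upTo-suc : (n : ℕ) (f : ℕ → ℚ) → ∑ (upTo (suc n)) f ≡ f 0 + ∑ (upTo n) (f ∘ suc)
∑-upTo-suc n f = cong (f 0 +_) (∑-applyUpTo suc n f)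

∑-upTo-last : (n : ℕ) (f : ℕ → ℚ) → ∑ (upTo (suc n)) f ≡ ∑ (upTo n) f + f n
∑-upTo-last n f = trans (cong (λ is → ∑ is f) (sym (List.upTo-∷ʳ n)))
  (trans (∑-++ (upTo n) (n ∷ [])) (cong (∑ (upTo n) f +_) (ℚ.+-identityʳ (f n))))

⟦_⟧ : Bool → ℚ
⟦ b ⟧ = if b then 1ℚ else 0ℚ

⟦⟧-∧ : ∀ b c → ⟦ b ∧ c ⟧ ≡ ⟦ b ⟧ * ⟦ c ⟧
⟦⟧-∧ true  c = sym (ℚ.*-identityˡ ⟦ c ⟧)
⟦⟧-∧ false c = sym (ℚ.*-zeroˡ ⟦ c ⟧)

-- Deconcatenation and shuffling

splits : List A → List (List A × List A)
splits []       = ([] , []) ∷ []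
splits (x ∷ w) = ([] , x ∷ w) ∷ map (Product.map₁ (x ∷_)) (splits w)

∑-splits-∷ : (x : A) (w : List A) (f : List A → List A → ℚ) →
  ∑ (splits (x ∷ w)) (λ (u , v) → f u v) ≡ f [] (x ∷ w) + ∑ (splits w) (λ (u , v) → f (x ∷ u) v)
∑-splits-∷ x w f = cong (f [] (x ∷ w) +_) (∑-map (Product.map₁ (x ∷_)) (splits w))

∑-take-drop : (w : List A) (f : List A → List A → ℚ) →
  ∑ (upTo (suc (length w))) (λ i → f (take i w) (drop i w)) ≡ ∑ (splits w) (λ (u , v) → f u v)
∑-take-drop []      f = refl
∑-take-drop (x ∷ w) f = trans
  (∑-upTo-suc (suc (length w)) (λ i → f (take i (x ∷ w)) (drop i (x ∷ w))))
  (trans (cong (f [] (x ∷ w) +_) (∑-take-drop w (f ∘ (x ∷_)))) (sym (∑-splits-∷ x w f)))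

-- Both sides run over the factorisations of `w` into three words: this is coassociativity of
-- deconcatenation.
splits-coassoc : (w : List A) (f : List A → List A → List A → ℚ) →
  ∑ (splits w) (λ (u , v) → ∑ (splits v) (λ (v₁ , v₂) → f u v₁ v₂)) ≡
  ∑ (splits w) (λ (u , v) → ∑ (splits u) (λ (u₁ , u₂) → f u₁ u₂ v))
splits-coassoc []      f = refl
splits-coassoc (x ∷ w) f = begin
  ∑ (splits (x ∷ w)) (λ (u , v) → ∑ (splits v) (λ (v₁ , v₂) → f u v₁ v₂))
    ≡⟨ ∑-splits-∷ x w (λ u v → ∑ (splits v) (λ (v₁ , v₂) → f u v₁ v₂)) ⟩
  ∑ (splits (x ∷ w)) (λ (v₁ , v₂) → f [] v₁ v₂) +
  ∑ (splits w) (λ (u , v) → ∑ (splits v) (λ (v₁ , v₂) → f (x ∷ u) v₁ v₂))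
    ≡⟨ cong₂ _+_ (∑-splits-∷ x w (f [])) (splits-coassoc w (f ∘ (x ∷_))) ⟩
  (f [] [] (x ∷ w) + ∑ (splits w) (λ (u , v) → f [] (x ∷ u) v)) +
  ∑ (splits w) (λ (u , v) → ∑ (splits u) (λ (u₁ , u₂) → f (x ∷ u₁) u₂ v))
    ≡⟨ ℚ.+-assoc (f [] [] (x ∷ w)) _ _ ⟩
  f [] [] (x ∷ w) + (∑ (splits w) (λ (u , v) → f [] (x ∷ u) v) +
  ∑ (splits w) (λ (u , v) → ∑ (splits u) (λ (u₁ , u₂) → f (x ∷ u₁) u₂ v)))
    ≡⟨ cong₂ _+_ (ℚ.+-identityʳ (f [] [] (x ∷ w)))
         (trans (∑-cong (splits w) λ (u , v) → ∑-splits-∷ x u (λ u₁ u₂ → f u₁ u₂ v))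
                (∑-+ (splits w) (λ (u , v) → f [] (x ∷ u) v) _)) ⟨
  (f [] [] (x ∷ w) + 0ℚ) +
  ∑ (splits w) (λ (u , v) → ∑ (splits (x ∷ u)) (λ (u₁ , u₂) → f u₁ u₂ v))
    ≡⟨ ∑-splits-∷ x w (λ u v → ∑ (splits u) (λ (u₁ , u₂) → f u₁ u₂ v)) ⟨
  ∑ (splits (x ∷ w)) (λ (u , v) → ∑ (splits u) (λ (u₁ , u₂) → f u₁ u₂ v)) ∎
  where open ≡-Reasoning

shuffles-[]ʳ : ∀ w → shuffles w [] ≡ w ∷ []
shuffles-[]ʳ []      = refl
shuffles-[]ʳ (x ∷ w) = refl

∑-shuffles-[]ʳ : ∀ w (f : List ℕ → ℚ) → ∑ (shuffles w []) f ≡ f w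
∑-shuffles-[]ʳ w f =
  trans (cong (λ ws → ∑ ws f) (shuffles-[]ʳ w)) (ℚ.+-identityʳ (f w))

∑-shuffles-∷ : ∀ x u y v (f : List ℕ → ℚ) → ∑ (shuffles (x ∷ u) (y ∷ v)) f ≡
  ∑ (shuffles u (y ∷ v)) (f ∘ (x ∷_)) + ∑ (shuffles (x ∷ u) v) (f ∘ (y ∷_))
∑-shuffles-∷ x u y v f = trans (∑-++ (map (x ∷_) (shuffles u (y ∷ v))) _)
  (cong₂ _+_ (∑-map (x ∷_) (shuffles u (y ∷ v))) (∑-map (y ∷_) (shuffles (x ∷ u) v)))

-- The value of the bilinear extension of `f` on the product of `u₁ ⊗ u₂` and `v₁ ⊗ v₂` in the
-- tensor square of the shuffle algebra.
shuffles₂ : (List ℕ → List ℕ → ℚ) → (u₁ u₂ v₁ v₂ : List ℕ) → ℚ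
shuffles₂ f u₁ u₂ v₁ v₂ = ∑ (shuffles u₁ v₁) λ p → ∑ (shuffles u₂ v₂) λ s → f p s

-- The bialgebra axiom: a cut of a shuffle cuts `u` and `v` as well, and the two sides of the cut
-- are shuffled independently. The induction removes the first letter of the shuffle, or stops when
-- the cut precedes it.
splits-shuffles : ∀ u v (f : List ℕ → List ℕ → ℚ) →
  ∑ (shuffles u v) (λ τ → ∑ (splits τ) (λ (p , s) → f p s)) ≡
  ∑ (splits u) (λ (u₁ , u₂) → ∑ (splits v) (λ (v₁ , v₂) → shuffles₂ f u₁ u₂ v₁ v₂))
splits-shuffles [] v f = trans (ℚ.+-identityʳ _) (sym (trans (ℚ.+-identityʳ _)
  (∑-cong (splits v) λ (v₁ , v₂) → trans (ℚ.+-identityʳ _) (ℚ.+-identityʳ (f v₁ v₂)))))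
splits-shuffles u@(_ ∷ _) [] f = trans (ℚ.+-identityʳ _)
  (∑-cong (splits u) λ (u₁ , u₂) → sym (trans (ℚ.+-identityʳ _)
    (trans (∑-shuffles-[]ʳ u₁ (λ p → ∑ (shuffles u₂ []) (f p))) (∑-shuffles-[]ʳ u₂ (f u₁)))))
splits-shuffles (x ∷ u) (y ∷ v) f = begin
  ∑ (shuffles (x ∷ u) (y ∷ v)) (λ τ → ∑ (splits τ) (λ (p , s) → f p s))
    ≡⟨ ∑-shuffles-∷ x u y v _ ⟩
  ∑ (shuffles u (y ∷ v)) (λ τ → ∑ (splits (x ∷ τ)) (λ (p , s) → f p s)) +
  ∑ (shuffles (x ∷ u) v) (λ τ → ∑ (splits (y ∷ τ)) (λ (p , s) → f p s))
    ≡⟨ cong₂ _+_ (first-letter x (shuffles u (y ∷ v))) (first-letter y (shuffles (x ∷ u) v)) ⟩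
  (a₁ + ∑ (shuffles u (y ∷ v)) (λ τ → ∑ (splits τ) (λ (p , s) → f (x ∷ p) s))) +
  (a₂ + ∑ (shuffles (x ∷ u) v) (λ τ → ∑ (splits τ) (λ (p , s) → f (y ∷ p) s)))
    ≡⟨ cong₂ (λ p q → (a₁ + p) + (a₂ + q))
         (trans (splits-shuffles u (y ∷ v) (f ∘ (x ∷_)))
           (trans (∑-cong (splits u) λ (u₁ , u₂) → ∑-splits-∷ y v (shuffles₂ (f ∘ (x ∷_)) u₁ u₂))
                  (∑-+ (splits u) _ _)))
         (trans (splits-shuffles (x ∷ u) v (f ∘ (y ∷_)))
           (∑-splits-∷ x u λ u₁ u₂ → ∑ (splits v) λ (v₁ , v₂) → shuffles₂ (f ∘ (y ∷_)) u₁ u₂ v₁ v₂)) ⟩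
  (a₁ + (b + c₁)) + (a₂ + (d + c₂))
    ≡⟨ +-interchange a₁ (b + c₁) a₂ (d + c₂) ⟩
  (a₁ + a₂) + ((b + c₁) + (d + c₂))
    ≡⟨ cong ((a₁ + a₂) +_) (trans (cong (_+ (d + c₂)) (ℚ.+-comm b c₁))
         (trans (+-interchange c₁ b d c₂)
         (trans (cong₂ _+_ (ℚ.+-comm c₁ d) (ℚ.+-comm b c₂))
         (trans (ℚ.+-assoc d c₁ (c₂ + b)) (cong (d +_)
         (trans (sym (ℚ.+-assoc c₁ c₂ b)) (ℚ.+-comm (c₁ + c₂) b))))))) ⟩
  (a₁ + a₂) + (d + (b + (c₁ + c₂)))
    ≡⟨ sym (ℚ.+-assoc (a₁ + a₂) d _) ⟩
  ((a₁ + a₂) + d) + (b + (c₁ + c₂))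
    ≡⟨ cong₂ _+_ left right ⟩
  ∑ (splits (y ∷ v)) (λ (v₁ , v₂) → shuffles₂ f [] (x ∷ u) v₁ v₂) +
  ∑ (splits u) (λ (u₁ , u₂) → ∑ (splits (y ∷ v)) (λ (v₁ , v₂) → shuffles₂ f (x ∷ u₁) u₂ v₁ v₂))
    ≡⟨ ∑-splits-∷ x u (λ u₁ u₂ → ∑ (splits (y ∷ v)) (λ (v₁ , v₂) → shuffles₂ f u₁ u₂ v₁ v₂)) ⟨
  ∑ (splits (x ∷ u)) (λ (u₁ , u₂) → ∑ (splits (y ∷ v)) (λ (v₁ , v₂) → shuffles₂ f u₁ u₂ v₁ v₂)) ∎
  where
  open ≡-Reasoning
  -- The cuts are sorted by which of the prefixes `u₁`, `v₁` are empty: both in `a₁` and `a₂`, only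
  -- `v₁` in `b`, only `u₁` in `d`, neither in `c₁` and `c₂`. The index tells whether the shuffle
  -- starts with `x` or with `y`; in `b` and `d` the empty prefix settles this.
  a₁ a₂ b c₁ d c₂ : ℚ
  a₁ = ∑ (shuffles u (y ∷ v)) λ τ → f [] (x ∷ τ)
  a₂ = ∑ (shuffles (x ∷ u) v) λ τ → f [] (y ∷ τ)
  b  = ∑ (splits u) λ (u₁ , u₂) → shuffles₂ (f ∘ (x ∷_)) u₁ u₂ [] (y ∷ v)
  c₁ = ∑ (splits u) λ (u₁ , u₂) → ∑ (splits v) λ (v₁ , v₂) → shuffles₂ (f ∘ (x ∷_)) u₁ u₂ (y ∷ v₁) v₂
  d  = ∑ (splits v) λ (v₁ , v₂) → shuffles₂ (f ∘ (y ∷_)) [] (x ∷ u) v₁ v₂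
  c₂ = ∑ (splits u) λ (u₁ , u₂) → ∑ (splits v) λ (v₁ , v₂) → shuffles₂ (f ∘ (y ∷_)) (x ∷ u₁) u₂ v₁ v₂
  first-letter : ∀ z τs → ∑ τs (λ τ → ∑ (splits (z ∷ τ)) (λ (p , s) → f p s)) ≡
    ∑ τs (λ τ → f [] (z ∷ τ)) + ∑ τs (λ τ → ∑ (splits τ) (λ (p , s) → f (z ∷ p) s))
  first-letter z τs = trans (∑-cong τs λ τ → ∑-splits-∷ z τ f) (∑-+ τs _ _)
  left : (a₁ + a₂) + d ≡ ∑ (splits (y ∷ v)) λ (v₁ , v₂) → shuffles₂ f [] (x ∷ u) v₁ v₂
  left = sym (trans (∑-splits-∷ y v (shuffles₂ f [] (x ∷ u)))
    (cong (_+ d) (trans (ℚ.+-identityʳ _) (∑-shuffles-∷ x u y v (f [])))))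
  right : b + (c₁ + c₂) ≡
    ∑ (splits u) λ (u₁ , u₂) → ∑ (splits (y ∷ v)) λ (v₁ , v₂) → shuffles₂ f (x ∷ u₁) u₂ v₁ v₂
  right = sym (trans
    (∑-cong (splits u) λ (u₁ , u₂) → trans (∑-splits-∷ y v (shuffles₂ f (x ∷ u₁) u₂))
      (cong₂ _+_
        (trans (ℚ.+-identityʳ _) (sym (∑-shuffles-[]ʳ u₁ _)))
        (trans (∑-cong (splits v) λ (v₁ , v₂) → ∑-shuffles-∷ x u₁ y v₁ _) (∑-+ (splits v) _ _))))
    (trans (∑-+ (splits u) _ _) (cong (b +_) (∑-+ (splits u) _ _))))

splits-++ : (w : List A) → All (λ (u , v) → u ++ v ≡ w) (splits w)
splits-++ []      = refl ∷ []
splits-++ (x ∷ w) = refl ∷ All.map⁺ (All.map (cong (x ∷_)) (splits-++ w))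

-- Increasing words

increasingFrom : ℕ → List ℕ → Bool
increasingFrom x []      = true
increasingFrom x (y ∷ w) = (x ℕ.<ᵇ y) ∧ increasingFrom y w

increasing : List ℕ → Bool
increasing []      = true
increasing (x ∷ w) = increasingFrom x w

<ᵇ-true : ∀ {x y} → x < y → (x ℕ.<ᵇ y) ≡ true
<ᵇ-true {x} {y} = dec-true (x ℕ.<? y)

<ᵇ-false : ∀ {x y} → y ≤ x → (x ℕ.<ᵇ y) ≡ false
<ᵇ-false {x} {y} y≤x = dec-false (x ℕ.<? y) (ℕ.≤⇒≯ y≤x)

disjoint-tailˡ : ∀ {x : A} {u v} → Disjoint (x ∷ u) v → Disjoint u v
disjoint-tailˡ d (∈u , ∈v) = d (there ∈u , ∈v)

disjoint-tailʳ : ∀ {y : A} {u v} → Disjoint u (y ∷ v) → Disjoint u v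
disjoint-tailʳ d (∈u , ∈v) = d (∈u , there ∈v)

-- If x < y then only the merge starting with x can be increasing.
merge-heads : ∀ {x y} → x ≢ y → ∀ b c →
  ⟦ b ⟧ * ⟦ (x ℕ.<ᵇ y) ∧ c ⟧ + ⟦ (y ℕ.<ᵇ x) ∧ b ⟧ * ⟦ c ⟧ ≡ ⟦ b ⟧ * ⟦ c ⟧
merge-heads {x} {y} x≢y b c with ℕ.<-cmp x y
... | tri≈ _ x≡y _ = ⊥-elim (x≢y x≡y)
... | tri< x<y _ _ rewrite <ᵇ-true x<y | <ᵇ-false (ℕ.<⇒≤ x<y) =
  trans (cong (⟦ b ⟧ * ⟦ c ⟧ +_) (ℚ.*-zeroˡ ⟦ c ⟧)) (ℚ.+-identityʳ (⟦ b ⟧ * ⟦ c ⟧))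
... | tri> _ _ y<x rewrite <ᵇ-true y<x | <ᵇ-false (ℕ.<⇒≤ y<x) =
  trans (cong (_+ ⟦ b ⟧ * ⟦ c ⟧) (ℚ.*-zeroʳ ⟦ b ⟧)) (ℚ.+-identityˡ (⟦ b ⟧ * ⟦ c ⟧))

-- The smaller head decides the bound as well: if it exceeds `k` then so does the other head, and if
-- it does not, both sides vanish.
merge-heads-from : ∀ k {x y} → x ≢ y → ∀ b c →
  ⟦ k ℕ.<ᵇ x ⟧ * (⟦ b ⟧ * ⟦ (x ℕ.<ᵇ y) ∧ c ⟧) + ⟦ k ℕ.<ᵇ y ⟧ * (⟦ (y ℕ.<ᵇ x) ∧ b ⟧ * ⟦ c ⟧) ≡
  ⟦ (k ℕ.<ᵇ x) ∧ b ⟧ * ⟦ (k ℕ.<ᵇ y) ∧ c ⟧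
merge-heads-from k {x} {y} x≢y b c with ℕ.<-cmp x y
... | tri≈ _ x≡y _ = ⊥-elim (x≢y x≡y)
... | tri< x<y _ _ rewrite <ᵇ-true x<y | <ᵇ-false (ℕ.<⇒≤ x<y) with k ℕ.<? x
...   | yes k<x rewrite <ᵇ-true k<x | <ᵇ-true (ℕ.<-trans k<x x<y) = both b c
  where
  both : ∀ b c → 1ℚ * (⟦ b ⟧ * ⟦ c ⟧) + 1ℚ * (0ℚ * ⟦ c ⟧) ≡ ⟦ b ⟧ * ⟦ c ⟧
  both false false = refl
  both false true  = refl
  both true  false = refl
  both true  true  = refl
...   | no k≮x rewrite <ᵇ-false (ℕ.≮⇒≥ k≮x) = none (k ℕ.<ᵇ y) b c
  where
  none : ∀ e b c → 0ℚ * (⟦ b ⟧ * ⟦ c ⟧) + ⟦ e ⟧ * (0ℚ * ⟦ c ⟧) ≡ 0ℚ * ⟦ e ∧ c ⟧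
  none false false false = refl
  none false false true  = refl
  none false true  false = refl
  none false true  true  = refl
  none true  false false = refl
  none true  false true  = refl
  none true  true  false = refl
  none true  true  true  = refl
merge-heads-from k {x} {y} x≢y b c | tri> _ _ y<x rewrite <ᵇ-true y<x | <ᵇ-false (ℕ.<⇒≤ y<x) with k ℕ.<? y
...   | yes k<y rewrite <ᵇ-true k<y | <ᵇ-true (ℕ.<-trans k<y y<x) = both b c
  where
  both : ∀ b c → 1ℚ * (⟦ b ⟧ * 0ℚ) + 1ℚ * (⟦ b ⟧ * ⟦ c ⟧) ≡ ⟦ b ⟧ * ⟦ c ⟧
  both false false = refl
  both false true  = refl
  both true  false = refl
  both true  true  = refl
...   | no k≮y rewrite <ᵇ-false (ℕ.≮⇒≥ k≮y) = none (k ℕ.<ᵇ x) b c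
  where
  none : ∀ e b c → ⟦ e ⟧ * (⟦ b ⟧ * 0ℚ) + 0ℚ * (⟦ b ⟧ * ⟦ c ⟧) ≡ ⟦ e ∧ b ⟧ * 0ℚ
  none false false false = refl
  none false false true  = refl
  none false true  false = refl
  none false true  true  = refl
  none true  false false = refl
  none true  false true  = refl
  none true  true  false = refl
  none true  true  true  = refl

-- The bound `k` records the last letter already placed, so the induction hypothesis applies to what
-- remains after either head is chosen.
shuffles-increasingFrom : ∀ k u v → Disjoint u v →
  ∑ (shuffles u v) (⟦_⟧ ∘ increasingFrom k) ≡ ⟦ increasingFrom k u ⟧ * ⟦ increasingFrom k v ⟧
shuffles-increasingFrom k [] v d =
  trans (ℚ.+-identityʳ ⟦ increasingFrom k v ⟧) (sym (ℚ.*-identityˡ ⟦ increasingFrom k v ⟧))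
shuffles-increasingFrom k u@(_ ∷ _) [] d =
  trans (ℚ.+-identityʳ ⟦ increasingFrom k u ⟧) (sym (ℚ.*-identityʳ ⟦ increasingFrom k u ⟧))
shuffles-increasingFrom k (x ∷ u) (y ∷ v) d = begin
  ∑ (shuffles (x ∷ u) (y ∷ v)) (⟦_⟧ ∘ increasingFrom k)
    ≡⟨ ∑-shuffles-∷ x u y v (⟦_⟧ ∘ increasingFrom k) ⟩
  ∑ (shuffles u (y ∷ v)) (λ τ → ⟦ (k ℕ.<ᵇ x) ∧ increasingFrom x τ ⟧) +
  ∑ (shuffles (x ∷ u) v) (λ τ → ⟦ (k ℕ.<ᵇ y) ∧ increasingFrom y τ ⟧)
    ≡⟨ cong₂ _+_ (bound x (shuffles u (y ∷ v))) (bound y (shuffles (x ∷ u) v)) ⟩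
  ⟦ k ℕ.<ᵇ x ⟧ * ∑ (shuffles u (y ∷ v)) (⟦_⟧ ∘ increasingFrom x) +
  ⟦ k ℕ.<ᵇ y ⟧ * ∑ (shuffles (x ∷ u) v) (⟦_⟧ ∘ increasingFrom y)
    ≡⟨ cong₂ (λ p q → ⟦ k ℕ.<ᵇ x ⟧ * p + ⟦ k ℕ.<ᵇ y ⟧ * q)
         (shuffles-increasingFrom x u (y ∷ v) (disjoint-tailˡ d))
         (shuffles-increasingFrom y (x ∷ u) v (disjoint-tailʳ d)) ⟩
  ⟦ k ℕ.<ᵇ x ⟧ * (⟦ increasingFrom x u ⟧ * ⟦ increasingFrom x (y ∷ v) ⟧) +
  ⟦ k ℕ.<ᵇ y ⟧ * (⟦ increasingFrom y (x ∷ u) ⟧ * ⟦ increasingFrom y v ⟧)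
    ≡⟨ merge-heads-from k {x} {y} (λ { refl → d (here refl , here refl) }) (increasingFrom x u) (increasingFrom y v) ⟩
  ⟦ increasingFrom k (x ∷ u) ⟧ * ⟦ increasingFrom k (y ∷ v) ⟧ ∎
  where
  open ≡-Reasoning
  bound : ∀ z τs → ∑ τs (λ τ → ⟦ (k ℕ.<ᵇ z) ∧ increasingFrom z τ ⟧) ≡
    ⟦ k ℕ.<ᵇ z ⟧ * ∑ τs (⟦_⟧ ∘ increasingFrom z)
  bound z τs = trans (∑-cong τs λ τ → ⟦⟧-∧ (k ℕ.<ᵇ z) (increasingFrom z τ))
    (sym (*-∑ ⟦ k ℕ.<ᵇ z ⟧ τs (⟦_⟧ ∘ increasingFrom z)))

shuffles-increasing : ∀ u v → Disjoint u v →
  ∑ (shuffles u v) (⟦_⟧ ∘ increasing) ≡ ⟦ increasing u ⟧ * ⟦ increasing v ⟧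
shuffles-increasing [] v d =
  trans (ℚ.+-identityʳ ⟦ increasing v ⟧) (sym (ℚ.*-identityˡ ⟦ increasing v ⟧))
shuffles-increasing u@(_ ∷ _) [] d =
  trans (ℚ.+-identityʳ ⟦ increasing u ⟧) (sym (ℚ.*-identityʳ ⟦ increasing u ⟧))
shuffles-increasing (x ∷ u) (y ∷ v) d = trans (∑-shuffles-∷ x u y v (⟦_⟧ ∘ increasing))
  (trans (cong₂ _+_
    (shuffles-increasingFrom x u (y ∷ v) (disjoint-tailˡ d))
    (shuffles-increasingFrom y (x ∷ u) v (disjoint-tailʳ d)))
  (merge-heads {x} {y} (λ { refl → d (here refl , here refl) }) (increasingFrom x u) (increasingFrom y v)))

-- ζ n w is the coefficient of x₁ⁿ in the fundamental function of w.
ζ : ℕ → List ℕ → ℚ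
ζ n w = ⟦ length w ≡ᵇ n ⟧ * ⟦ increasing w ⟧

-- Only `i = p` can contribute, and it lies in the range exactly when `p ≤ n`; within the range
-- `n ∸ i` is a true difference.
∑-≡ᵇ : ∀ n p q → ∑ (upTo (suc n)) (λ i → ⟦ p ≡ᵇ i ⟧ * ⟦ q ≡ᵇ (n ℕ.∸ i) ⟧) ≡ ⟦ (p ℕ.+ q) ≡ᵇ n ⟧
∑-≡ᵇ zero zero    q = trans (ℚ.+-identityʳ _) (ℚ.*-identityˡ _)
∑-≡ᵇ zero (suc p) q = trans (ℚ.+-identityʳ (0ℚ * ⟦ q ≡ᵇ 0 ⟧)) (ℚ.*-zeroˡ ⟦ q ≡ᵇ 0 ⟧)
∑-≡ᵇ (suc n) zero q = trans
  (∑-upTo-suc (suc n) (λ i → ⟦ 0 ≡ᵇ i ⟧ * ⟦ q ≡ᵇ (suc n ℕ.∸ i) ⟧))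
  (trans (cong₂ _+_ (ℚ.*-identityˡ ⟦ q ≡ᵇ suc n ⟧)
    (trans (∑-cong (upTo (suc n)) λ i → ℚ.*-zeroˡ ⟦ q ≡ᵇ (n ℕ.∸ i) ⟧) (∑-0 (upTo (suc n)))))
    (ℚ.+-identityʳ _))
∑-≡ᵇ (suc n) (suc p) q = trans
  (∑-upTo-suc (suc n) (λ i → ⟦ suc p ≡ᵇ i ⟧ * ⟦ q ≡ᵇ (suc n ℕ.∸ i) ⟧))
  (trans (cong₂ _+_ (ℚ.*-zeroˡ ⟦ q ≡ᵇ suc n ⟧) (∑-≡ᵇ n p q)) (ℚ.+-identityˡ _))

-- All shuffles have the same length, so the length indicator leaves the sum. In effect, sending an
-- increasing word to the power of a variable given by its length, and any other word to 0, is
-- multiplicative on disjoint words.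
shuffles-ζ : ∀ n u v → Disjoint u v →
  ∑ (shuffles u v) (ζ n) ≡ ∑ (upTo (suc n)) (λ i → ζ i u * ζ (n ℕ.∸ i) v)
shuffles-ζ n u v d = begin
  ∑ (shuffles u v) (ζ n)
    ≡⟨ ∑-cong-All (All.map (λ {τ} τ↭ → cong (λ l → ⟦ l ≡ᵇ n ⟧ * ⟦ increasing τ ⟧)
         (trans (↭-length τ↭) (List.length-++ u))) (shuffles-↭ u v)) ⟩
  ∑ (shuffles u v) (λ τ → L * ⟦ increasing τ ⟧)
    ≡⟨ *-∑ L (shuffles u v) (⟦_⟧ ∘ increasing) ⟨
  L * ∑ (shuffles u v) (⟦_⟧ ∘ increasing)
    ≡⟨ cong₂ _*_ (sym (∑-≡ᵇ n (length u) (length v))) (shuffles-increasing u v d) ⟩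
  ∑ (upTo (suc n)) (λ i → ⟦ length u ≡ᵇ i ⟧ * ⟦ length v ≡ᵇ (n ℕ.∸ i) ⟧) *
  (⟦ increasing u ⟧ * ⟦ increasing v ⟧)
    ≡⟨ ∑-* (upTo (suc n)) (λ i → ⟦ length u ≡ᵇ i ⟧ * ⟦ length v ≡ᵇ (n ℕ.∸ i) ⟧) (⟦ increasing u ⟧ * ⟦ increasing v ⟧) ⟩
  ∑ (upTo (suc n)) (λ i → (⟦ length u ≡ᵇ i ⟧ * ⟦ length v ≡ᵇ (n ℕ.∸ i) ⟧) * (⟦ increasing u ⟧ * ⟦ increasing v ⟧))
    ≡⟨ ∑-cong (upTo (suc n)) (λ i → *-interchange ⟦ length u ≡ᵇ i ⟧ ⟦ length v ≡ᵇ (n ℕ.∸ i) ⟧ ⟦ increasing u ⟧ ⟦ increasing v ⟧) ⟩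
  ∑ (upTo (suc n)) (λ i → ζ i u * ζ (n ℕ.∸ i) v) ∎
  where
  open ≡-Reasoning
  L : ℚ
  L = ⟦ (length u ℕ.+ length v) ≡ᵇ n ⟧

-- The fundamental function of a word

fundamental : List ℕ → Monomial → ℚ
fundamental w []      = ⟦ null w ⟧
fundamental w (n ∷ a) = ∑ (splits w) λ (u , v) → ζ n u * fundamental v a

-- `splits-shuffles` separates the block of the first variable from the rest: `shuffles-ζ` handles
-- the prefixes and induction on `a` the suffixes. Disjointness passes to the parts because they
-- concatenate back to `u` and `v`.
fundamental-shuffles : ∀ a u v → Disjoint u v →
  ∑ (shuffles u v) (λ τ → fundamental τ a) ≡ mulCoeff (fundamental u) (fundamental v) a
fundamental-shuffles [] [] v d = cong (_+ 0ℚ) (sym (ℚ.*-identityˡ ⟦ null v ⟧))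
fundamental-shuffles [] (x ∷ u) [] d = refl
fundamental-shuffles [] (x ∷ u) (y ∷ v) d = trans (∑-shuffles-∷ x u y v (⟦_⟧ ∘ null))
  (cong₂ _+_ (∑-0 (shuffles u (y ∷ v))) (∑-0 (shuffles (x ∷ u) v)))
fundamental-shuffles (n ∷ a) u v d = begin
  ∑ (shuffles u v) (λ τ → ∑ (splits τ) (λ (p , s) → ζ n p * fundamental s a))
    ≡⟨ splits-shuffles u v (λ p s → ζ n p * fundamental s a) ⟩
  ∑ (splits u) (λ (u₁ , u₂) → ∑ (splits v) (λ (v₁ , v₂) →
    shuffles₂ (λ p s → ζ n p * fundamental s a) u₁ u₂ v₁ v₂))
    ≡⟨ ∑-cong-All (All.map (λ {(u₁ , u₂)} u≡ → ∑-cong-All (All.map (λ {(v₁ , v₂)} v≡ →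
         trans (∑-product (shuffles u₁ v₁) (shuffles u₂ v₂) (ζ n) (λ s → fundamental s a))
         (trans (cong₂ _*_
           (shuffles-ζ n u₁ v₁ (λ (∈u , ∈v) → d
             (subst (_ ∈_) u≡ (∈-++⁺ˡ ∈u) , subst (_ ∈_) v≡ (∈-++⁺ˡ ∈v))))
           (fundamental-shuffles a u₂ v₂ (λ (∈u , ∈v) → d
             (subst (_ ∈_) u≡ (∈-++⁺ʳ u₁ ∈u) , subst (_ ∈_) v≡ (∈-++⁺ʳ v₁ ∈v)))))
         (sym (∑-product (upTo (suc n)) (factorisations a)
           (λ i → ζ i u₁ * ζ (n ℕ.∸ i) v₁) (λ (b , c) → fundamental u₂ b * fundamental v₂ c))))) (splits-++ v))) (splits-++ u)) ⟩
  ∑ (splits u) (λ (u₁ , u₂) → ∑ (splits v) (λ (v₁ , v₂) →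
    ∑ (upTo (suc n)) (λ i → ∑ (factorisations a) (λ (b , c) →
      (ζ i u₁ * ζ (n ℕ.∸ i) v₁) * (fundamental u₂ b * fundamental v₂ c)))))
    -- The sums over exponents move outside the sums over cuts, matching the shape of `mulCoeff-∷`.
    ≡⟨ ∑-cong (splits u) (λ _ → trans (∑-swap (splits v) (upTo (suc n)) _)
         (∑-cong (upTo (suc n)) λ _ → ∑-swap (splits v) (factorisations a) _)) ⟩
  ∑ (splits u) (λ (u₁ , u₂) →
    ∑ (upTo (suc n)) (λ i → ∑ (factorisations a) (λ (b , c) → ∑ (splits v) (λ (v₁ , v₂) →
      (ζ i u₁ * ζ (n ℕ.∸ i) v₁) * (fundamental u₂ b * fundamental v₂ c)))))
    ≡⟨ trans (∑-swap (splits u) (upTo (suc n)) _)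
         (∑-cong (upTo (suc n)) λ _ → ∑-swap (splits u) (factorisations a) _) ⟩
  ∑ (upTo (suc n)) (λ i → ∑ (factorisations a) (λ (b , c) →
    ∑ (splits u) (λ (u₁ , u₂) → ∑ (splits v) (λ (v₁ , v₂) →
      (ζ i u₁ * ζ (n ℕ.∸ i) v₁) * (fundamental u₂ b * fundamental v₂ c)))))
    ≡⟨ ∑-cong (upTo (suc n)) (λ i → ∑-cong (factorisations a) λ (b , c) →
         trans (∑-cong (splits u) λ (u₁ , u₂) → ∑-cong (splits v) λ (v₁ , v₂) →
                 *-interchange (ζ i u₁) (ζ (n ℕ.∸ i) v₁) (fundamental u₂ b) (fundamental v₂ c))
               (∑-product (splits u) (splits v) _ _)) ⟩
  ∑ (upTo (suc n)) (λ i → mulCoeff (fundamental u ∘ (i ∷_)) (fundamental v ∘ ((n ℕ.∸ i) ∷_)) a)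
    ≡⟨ mulCoeff-∷ (fundamental u) (fundamental v) n a ⟨
  mulCoeff (fundamental u) (fundamental v) (n ∷ a) ∎
  where open ≡-Reasoning

-- The variables of `a` consume a prefix of `w` and those of `b` the remaining suffix;
-- coassociativity brings the block of the first variable of `a` to the outside.
fundamental-++ : ∀ a b w →
  ∑ (splits w) (λ (u , v) → fundamental u a * fundamental v b) ≡ fundamental w (a ++ b)
fundamental-++ [] b [] = trans (ℚ.+-identityʳ _) (ℚ.*-identityˡ (fundamental [] b))
fundamental-++ [] b (x ∷ w) = trans (∑-splits-∷ x w (λ u v → ⟦ null u ⟧ * fundamental v b))
  (trans (cong₂ _+_ (ℚ.*-identityˡ (fundamental (x ∷ w) b))
    (trans (∑-cong (splits w) λ (_ , v) → ℚ.*-zeroˡ (fundamental v b)) (∑-0 (splits w))))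
  (ℚ.+-identityʳ _))
fundamental-++ (n ∷ a) b w = begin
  ∑ (splits w) (λ (u , v) → ∑ (splits u) (λ (u₁ , u₂) → ζ n u₁ * fundamental u₂ a) * fundamental v b)
    ≡⟨ ∑-cong (splits w) (λ (u , v) → ∑-* (splits u) _ (fundamental v b)) ⟩
  ∑ (splits w) (λ (u , v) → ∑ (splits u) (λ (u₁ , u₂) → (ζ n u₁ * fundamental u₂ a) * fundamental v b))
    ≡⟨ splits-coassoc w (λ u₁ u₂ v → (ζ n u₁ * fundamental u₂ a) * fundamental v b) ⟨
  ∑ (splits w) (λ (u , v) → ∑ (splits v) (λ (v₁ , v₂) → (ζ n u * fundamental v₁ a) * fundamental v₂ b))
    ≡⟨ ∑-cong (splits w) (λ (u , v) → trans
         (∑-cong (splits v) λ (v₁ , v₂) → ℚ.*-assoc (ζ n u) (fundamental v₁ a) (fundamental v₂ b))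
         (trans (sym (*-∑ (ζ n u) (splits v) _)) (cong (ζ n u *_) (fundamental-++ a b v)))) ⟩
  fundamental w (n ∷ a ++ b) ∎
  where open ≡-Reasoning

-- Descent compositions

-- just d encodes the composition of suc (length d) whose proper partial sums are
-- the positions (from 1) of true in d; nothing encodes the empty composition.
Shape : Set
Shape = Maybe (List Bool)

size : Shape → ℕ
size nothing  = 0
size (just d) = suc (length d)

blocks : List Bool → List ℕ
blocks []          = 1 ∷ []
blocks (true  ∷ d) = 1 ∷ blocks d
blocks (false ∷ d) = incrementHead (blocks d)

comp : Shape → List ℕ
comp nothing  = []
comp (just d) = blocks d

bits : (ℕ → ℕ → Bool) → ℕ → List ℕ → List Bool
bits r x []      = []
bits r x (y ∷ w) = r x y ∷ bits r y w

shape : (ℕ → ℕ → Bool) → List ℕ → Shape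
shape r []      = nothing
shape r (x ∷ w) = just (bits r x w)

descents ascents : List ℕ → Shape
descents = shape (λ x y → y ℕ.<ᵇ x)
ascents  = shape ℕ._<ᵇ_

marked : List Bool → List ℕ
marked []          = []
marked (true  ∷ d) = 1 ∷ map suc (marked d)
marked (false ∷ d) = map suc (marked d)

positions-marked : ∀ {R : Rel ℕ 0ℓ} (R? : Decidable R) x w →
  positions R? (x ∷ w) ≡ marked (bits (λ x y → does (R? x y)) x w)
positions-marked R? x []      = refl
positions-marked R? x (y ∷ w) with does (R? x y)
... | true  = cong (λ is → 1 ∷ map suc is) (positions-marked R? y w)
... | false = cong (map suc) (positions-marked R? y w)

length-bits : ∀ r x w → length (bits r x w) ≡ length w
length-bits r x []      = refl
length-bits r x (y ∷ w) = cong suc (length-bits r y w)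

size-shape : ∀ r w → size (shape r w) ≡ length w
size-shape r []      = refl
size-shape r (x ∷ w) = cong suc (length-bits r x w)

blocks-∷ : ∀ d → ∃ λ n → ∃ λ α → blocks d ≡ suc n ∷ α
blocks-∷ []          = 0 , [] , refl
blocks-∷ (true  ∷ d) = 0 , blocks d , refl
blocks-∷ (false ∷ d) with blocks-∷ d
... | n , α , eq = suc n , α , cong incrementHead eq

gaps-suc : ∀ p ds n → gaps (suc p) (map suc ds) (suc n) ≡ gaps p ds n
gaps-suc p []       n = refl
gaps-suc p (d ∷ ds) n = cong ((d ℕ.∸ p) ∷_) (gaps-suc d ds n)

-- All positions shift but the base `0` does not, so only the first gap grows. This is the effect of
-- a leading false bit.
gaps-0 : ∀ ds n → gaps 0 (map suc ds) (suc n) ≡ incrementHead (gaps 0 ds n)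
gaps-0 []       n = refl
gaps-0 (d ∷ ds) n = cong (suc d ∷_) (gaps-suc d ds n)

gaps-marked : ∀ d → gaps 0 (marked d) (suc (length d)) ≡ blocks d
gaps-marked []          = refl
gaps-marked (true  ∷ d) = cong (1 ∷_) (trans (gaps-suc 0 (marked d) _) (gaps-marked d))
gaps-marked (false ∷ d) = trans (gaps-0 (marked d) _) (cong incrementHead (gaps-marked d))

Comp-descents : ∀ π → Comp π ≡ comp (descents (letters π))
Comp-descents (perm []      _ _) = refl
Comp-descents (perm (x ∷ w) _ _) = trans
  (cong₂ (λ ds n → gaps 0 ds (suc n)) (positions-marked ℕ._>?_ x w) (sym (length-bits _ x w)))
  (gaps-marked (bits (λ x y → y ℕ.<ᵇ x) x w))

sum-blocks : ∀ d → sum (blocks d) ≡ suc (length d)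
sum-blocks []          = refl
sum-blocks (true  ∷ d) = cong suc (sum-blocks d)
sum-blocks (false ∷ d) with blocks d | blocks-∷ d | sum-blocks d
... | _ | n , α , refl | eq = cong suc eq

sum-comp : ∀ s → sum (comp s) ≡ size s
sum-comp nothing  = refl
sum-comp (just d) = sum-blocks d

partialSums-incrementHead : ∀ α → partialSums (incrementHead α) ≡ map suc (partialSums α)
partialSums-incrementHead []          = refl
partialSums-incrementHead (n ∷ [])    = refl
partialSums-incrementHead (n ∷ m ∷ α) = cong (suc n ∷_) (List.map-∘ (partialSums (m ∷ α)))

partialSums-blocks : ∀ d → partialSums (blocks d) ≡ marked d
partialSums-blocks []          = refl
partialSums-blocks (true  ∷ d) with blocks d | blocks-∷ d | partialSums-blocks d
... | _ | n , α , refl | eq = cong (λ is → 1 ∷ map suc is) eq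
partialSums-blocks (false ∷ d) =
  trans (partialSums-incrementHead (blocks d)) (cong (map suc) (partialSums-blocks d))

marked-positive : ∀ d → All (0 <_) (marked d)
marked-positive []          = []
marked-positive (true  ∷ d) = s≤s z≤n ∷ All.map⁺ (All.universal (λ _ → s≤s z≤n) (marked d))
marked-positive (false ∷ d) = All.map⁺ (All.universal (λ _ → s≤s z≤n) (marked d))

marked-suc⁺ : ∀ b e {i} → i ∈ marked e → suc i ∈ marked (b ∷ e)
marked-suc⁺ true  e i∈ = there (∈-map⁺ suc i∈)
marked-suc⁺ false e i∈ = ∈-map⁺ suc i∈

-- Positions count from 1, so `suc i` with `0 < i` cannot be the mark of the first bit and must come
-- from the tail.
marked-suc⁻ : ∀ b e {i} → 0 < i → suc i ∈ marked (b ∷ e) → i ∈ marked e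
marked-suc⁻ true  e () (here refl)
marked-suc⁻ true  e 0<i (there i∈) with ∈-map⁻ suc i∈
... | _ , i∈e , refl = i∈e
marked-suc⁻ false e 0<i i∈ with ∈-map⁻ suc i∈
... | _ , i∈e , refl = i∈e

-- Refinement of compositions as inclusion of marks

infix 4 _≼ᵇ_ _≼_
_≼ᵇ_ : List Bool → List Bool → Bool
[]      ≼ᵇ []      = true
[]      ≼ᵇ (_ ∷ _) = false
(_ ∷ _) ≼ᵇ []      = false
(b ∷ d) ≼ᵇ (c ∷ e) = (c ∨ not b) ∧ (d ≼ᵇ e)

-- comp t refines comp s
_≼_ : Shape → Shape → Bool
nothing ≼ nothing = true
nothing ≼ just _  = false
just _  ≼ nothing = false
just d  ≼ just e  = d ≼ᵇ e

≼ᵇ⇒marked : ∀ d e → T (d ≼ᵇ e) → length e ≡ length d × All (_∈ marked e) (marked d)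
≼ᵇ⇒marked [] [] _ = refl , []
≼ᵇ⇒marked (true ∷ d) (true ∷ e) d≼e with ≼ᵇ⇒marked d e d≼e
... | len , all = cong suc len , here refl ∷ All.map⁺ (All.map (marked-suc⁺ true e) all)
≼ᵇ⇒marked (false ∷ d) (true ∷ e) d≼e with ≼ᵇ⇒marked d e d≼e
... | len , all = cong suc len , All.map⁺ (All.map (marked-suc⁺ true e) all)
≼ᵇ⇒marked (false ∷ d) (false ∷ e) d≼e with ≼ᵇ⇒marked d e d≼e
... | len , all = cong suc len , All.map⁺ (All.map (marked-suc⁺ false e) all)

all-marked-suc⁻ : ∀ c d e → All (_∈ marked (c ∷ e)) (map suc (marked d)) → All (_∈ marked e) (marked d)
all-marked-suc⁻ c d e all = All.zipWith (λ (0<i , i∈) → marked-suc⁻ c e 0<i i∈) (marked-positive d , All.map⁻ all)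

marked⇒≼ᵇ : ∀ d e → length e ≡ length d → All (_∈ marked e) (marked d) → T (d ≼ᵇ e)
marked⇒≼ᵇ [] [] _ _ = _
marked⇒≼ᵇ (true ∷ d) (true ∷ e) len (_ ∷ all) =
  marked⇒≼ᵇ d e (ℕ.suc-injective len) (all-marked-suc⁻ true d e all)
marked⇒≼ᵇ (true ∷ d) (false ∷ e) len (1∈ ∷ _) with ∈-map⁻ suc 1∈
... | zero , 0∈ , _ = ⊥-elim (ℕ.<-irrefl refl (All.lookup (marked-positive e) 0∈))
marked⇒≼ᵇ (false ∷ d) (true ∷ e) len all =
  marked⇒≼ᵇ d e (ℕ.suc-injective len) (all-marked-suc⁻ true d e all)
marked⇒≼ᵇ (false ∷ d) (false ∷ e) len all =
  marked⇒≼ᵇ d e (ℕ.suc-injective len) (all-marked-suc⁻ false d e all)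

-- Turns the membership test defining `F` into a comparison of bits: the equation between `length w`
-- and the sum of parts becomes equality of lengths, and inclusion of partial sums among the strict
-- ascents becomes inclusion of marks.
occurs-≼ : ∀ s w → does (occurs? (comp s) (length w) (strictAscents w)) ≡ (s ≼ ascents w)
occurs-≼ nothing  []      = refl
occurs-≼ nothing  (x ∷ w) = refl
occurs-≼ (just d) []      = dec-false (occurs? (blocks d) 0 [])
  (λ (eq , _) → ℕ.0≢1+n (trans eq (sum-blocks d)))
occurs-≼ (just d) (x ∷ w) = does-⇔ (mk⇔ to from)
  (occurs? (blocks d) (suc (length w)) (strictAscents (x ∷ w))) (T? (d ≼ᵇ e))
  where
  e : List Bool
  e = bits ℕ._<ᵇ_ x w
  to : suc (length w) ≡ sum (blocks d) × All (_∈ strictAscents (x ∷ w)) (partialSums (blocks d)) → T (d ≼ᵇ e)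
  to (len , all) = marked⇒≼ᵇ d e
    (trans (length-bits _ x w) (ℕ.suc-injective (trans len (sum-blocks d))))
    (subst₂ (λ asc is → All (_∈ asc) is) (positions-marked ℕ._<?_ x w) (partialSums-blocks d) all)
  from : T (d ≼ᵇ e) → suc (length w) ≡ sum (blocks d) × All (_∈ strictAscents (x ∷ w)) (partialSums (blocks d))
  from d≼e with ≼ᵇ⇒marked d e d≼e
  ... | len , all =
    trans (cong suc (trans (sym (length-bits _ x w)) len)) (sym (sum-blocks d)) ,
    subst₂ (λ asc is → All (_∈ asc) is) (sym (positions-marked ℕ._<?_ x w)) (sym (partialSums-blocks d)) all

-- Agreement of F with the fundamental function of a word

coeff-F : ∀ s a → coeff (F (comp s)) a ≡ ⟦ s ≼ ascents (indices 1 a) ⟧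
coeff-F s a = cong ⟦_⟧ (occurs-≼ s (indices 1 a))

-- Distinct letters turn a non-descent into an ascent, so a run of false descent bits can be read as
-- an increasing word.
not-<ᵇ : ∀ {x y} → x ≢ y → not (y ℕ.<ᵇ x) ≡ (x ℕ.<ᵇ y)
not-<ᵇ {x} {y} x≢y with ℕ.<-cmp x y
... | tri< x<y _ _ rewrite <ᵇ-true x<y | <ᵇ-false (ℕ.<⇒≤ x<y) = refl
... | tri≈ _ x≡y _ = ⊥-elim (x≢y x≡y)
... | tri> _ _ y<x rewrite <ᵇ-true y<x | <ᵇ-false (ℕ.<⇒≤ y<x) = refl

∑-splits-null : ∀ (w : List A) (f : List A → List A → ℚ) → (∀ x u v → f (x ∷ u) v ≡ 0ℚ) →
  ∑ (splits w) (λ (u , v) → f u v) ≡ f [] w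
∑-splits-null []      f f≡0 = ℚ.+-identityʳ (f [] [])
∑-splits-null (x ∷ w) f f≡0 = trans (∑-splits-∷ x w f)
  (trans (cong (f [] (x ∷ w) +_) (trans (∑-cong (splits w) λ (u , v) → f≡0 x u v) (∑-0 (splits w))))
         (ℚ.+-identityʳ (f [] (x ∷ w))))

0*b*c : ∀ b c → (0ℚ * b) * c ≡ 0ℚ
0*b*c b c = trans (cong (_* c) (ℚ.*-zeroˡ b)) (ℚ.*-zeroˡ c)

-- The letter `x` is already matched with one copy of `k`. Each further copy of `k` gives a false
-- ascent bit, which forbids a descent, so the next `n` letters must extend an increasing run; the
-- jump from `k` into `i` gives a true bit, which imposes nothing.
≼-replicateFrom : ∀ n k x w i → Unique (x ∷ w) → All (k <_) i →
  ⟦ bits (λ x y → y ℕ.<ᵇ x) x w ≼ᵇ bits ℕ._<ᵇ_ k (replicate n k ++ i) ⟧ ≡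
  ∑ (splits w) (λ (u , v) → (⟦ length u ≡ᵇ n ⟧ * ⟦ increasingFrom x u ⟧) * ⟦ descents v ≼ ascents i ⟧)
≼-replicateFrom zero k x w i _ k<i = trans (start w i k<i) (sym (trans
  (∑-splits-null w (λ u v → (⟦ length u ≡ᵇ 0 ⟧ * ⟦ increasingFrom x u ⟧) * ⟦ descents v ≼ ascents i ⟧)
    (λ y u v → 0*b*c ⟦ increasingFrom x (y ∷ u) ⟧ ⟦ descents v ≼ ascents i ⟧))
  (ℚ.*-identityˡ ⟦ descents w ≼ ascents i ⟧)))
  where
  -- At the end of the block the first bit on the right is true, so whether `w` begins with a
  -- descent after `x` is irrelevant, and what remains compares the shapes of `w` and `i`.
  start : ∀ w i → All (k <_) i →
    ⟦ bits (λ x y → y ℕ.<ᵇ x) x w ≼ᵇ bits ℕ._<ᵇ_ k i ⟧ ≡ ⟦ descents w ≼ ascents i ⟧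
  start []      []      _ = refl
  start []      (l ∷ i) _ = refl
  start (y ∷ w) []      _ = refl
  start (y ∷ w) (l ∷ i) (k<l ∷ _) rewrite <ᵇ-true k<l = refl
≼-replicateFrom (suc n) k x [] i _ k<i =
  sym (trans (ℚ.+-identityʳ (0ℚ * ⟦ nothing ≼ ascents i ⟧)) (ℚ.*-zeroˡ ⟦ nothing ≼ ascents i ⟧))
-- The bit `k <ᵇ k` is false, so the first comparison reduces to the negated descent bit, which is
-- `x <ᵇ y`.
≼-replicateFrom (suc n) k x (y ∷ w) i ((x≢y ∷ _) ∷ uniq) k<i
  rewrite <ᵇ-false (ℕ.≤-refl {k}) | not-<ᵇ x≢y = begin
  ⟦ (x ℕ.<ᵇ y) ∧ (bits (λ x y → y ℕ.<ᵇ x) y w ≼ᵇ bits ℕ._<ᵇ_ k (replicate n k ++ i)) ⟧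
    ≡⟨ ⟦⟧-∧ (x ℕ.<ᵇ y) _ ⟩
  ⟦ x ℕ.<ᵇ y ⟧ * ⟦ bits (λ x y → y ℕ.<ᵇ x) y w ≼ᵇ bits ℕ._<ᵇ_ k (replicate n k ++ i) ⟧
    ≡⟨ cong (⟦ x ℕ.<ᵇ y ⟧ *_) (≼-replicateFrom n k y w i uniq k<i) ⟩
  ⟦ x ℕ.<ᵇ y ⟧ * ∑ (splits w) (λ (u , v) → (⟦ length u ≡ᵇ n ⟧ * ⟦ increasingFrom y u ⟧) * ⟦ descents v ≼ ascents i ⟧)
    ≡⟨ *-∑ ⟦ x ℕ.<ᵇ y ⟧ (splits w) _ ⟩
  ∑ (splits w) (λ (u , v) → ⟦ x ℕ.<ᵇ y ⟧ * ((⟦ length u ≡ᵇ n ⟧ * ⟦ increasingFrom y u ⟧) * ⟦ descents v ≼ ascents i ⟧))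
    ≡⟨ ∑-cong (splits w) (λ (u , v) → trans
         (sym (ℚ.*-assoc ⟦ x ℕ.<ᵇ y ⟧ (⟦ length u ≡ᵇ n ⟧ * ⟦ increasingFrom y u ⟧) ⟦ descents v ≼ ascents i ⟧))
         (cong (_* ⟦ descents v ≼ ascents i ⟧) (trans
           (*-swap ⟦ x ℕ.<ᵇ y ⟧ ⟦ length u ≡ᵇ n ⟧ ⟦ increasingFrom y u ⟧)
           (cong (⟦ length u ≡ᵇ n ⟧ *_) (sym (⟦⟧-∧ (x ℕ.<ᵇ y) (increasingFrom y u))))))) ⟩
  ∑ (splits w) (λ (u , v) → f (y ∷ u) v)
    ≡⟨ ℚ.+-identityˡ _ ⟨
  0ℚ + ∑ (splits w) (λ (u , v) → f (y ∷ u) v)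
    ≡⟨ cong (_+ ∑ (splits w) (λ (u , v) → f (y ∷ u) v)) (0*b*c 1ℚ ⟦ descents (y ∷ w) ≼ ascents i ⟧) ⟨
  f [] (y ∷ w) + ∑ (splits w) (λ (u , v) → f (y ∷ u) v)
    ≡⟨ ∑-splits-∷ y w f ⟨
  ∑ (splits (y ∷ w)) (λ (u , v) → f u v) ∎
  where
  open ≡-Reasoning
  f : List ℕ → List ℕ → ℚ
  f u v = (⟦ length u ≡ᵇ suc n ⟧ * ⟦ increasingFrom x u ⟧) * ⟦ descents v ≼ ascents i ⟧

≼-replicate : ∀ n k w i → Unique w → All (k <_) i →
  ⟦ descents w ≼ ascents (replicate n k ++ i) ⟧ ≡
  ∑ (splits w) (λ (u , v) → ζ n u * ⟦ descents v ≼ ascents i ⟧)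
≼-replicate zero k w i _ _ = sym (trans
  (∑-splits-null w (λ u v → ζ 0 u * ⟦ descents v ≼ ascents i ⟧)
    (λ y u v → 0*b*c ⟦ increasing (y ∷ u) ⟧ ⟦ descents v ≼ ascents i ⟧))
  (ℚ.*-identityˡ ⟦ descents w ≼ ascents i ⟧))
≼-replicate (suc n) k [] i _ _ =
  sym (trans (ℚ.+-identityʳ (0ℚ * ⟦ nothing ≼ ascents i ⟧)) (ℚ.*-zeroˡ ⟦ nothing ≼ ascents i ⟧))
≼-replicate (suc n) k (x ∷ w) i uniq k<i = trans (≼-replicateFrom n k x w i uniq k<i)
  (sym (trans (∑-splits-∷ x w (λ u v → ζ (suc n) u * ⟦ descents v ≼ ascents i ⟧))
    (trans (cong (_+ rest) (0*b*c 1ℚ ⟦ descents (x ∷ w) ≼ ascents i ⟧)) (ℚ.+-identityˡ rest))))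
  where
  rest : ℚ
  rest = ∑ (splits w) (λ (u , v) → (⟦ length u ≡ᵇ n ⟧ * ⟦ increasingFrom x u ⟧) * ⟦ descents v ≼ ascents i ⟧)

splits-unique : ∀ {w : List ℕ} → Unique w → All (λ (u , v) → Unique v) (splits w)
splits-unique []               = [] ∷ []
splits-unique (x∉w ∷ uniq) = (x∉w ∷ uniq) ∷ All.map⁺ (splits-unique uniq)

-- An exponent `n` contributes `n` equal indices, so `≼-replicate` is one step of the recursion for
-- `fundamental`. The first index `k` is arbitrary because the remaining indices start at `suc k`.
≼-fundamental : ∀ k a w → Unique w → ⟦ descents w ≼ ascents (indices k a) ⟧ ≡ fundamental w a
≼-fundamental k []      []      _ = refl
≼-fundamental k []      (x ∷ w) _ = refl
≼-fundamental k (n ∷ a) w uniq = trans (≼-replicate n k w (indices (suc k) a) uniq (indices-≥ (suc k) a))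
  (∑-cong-All (All.map (λ {(u , v)} u-v → cong (ζ n u *_) (≼-fundamental (suc k) a v u-v)) (splits-unique uniq)))

coeff-F-Comp : ∀ π a → coeff (F (Comp π)) a ≡ fundamental (letters π) a
coeff-F-Comp π a = trans (cong (λ α → coeff (F α) a) (Comp-descents π))
  (trans (coeff-F (descents (letters π)) a) (≼-fundamental 1 a (letters π) (distinct π)))

-- Shapes index the compositions

-- The index word of the monomial with exponents `blocks d` jumps exactly at the marks of `d`. Hence
-- reading off its ascents inverts `comp`, which gives injectivity and evaluates `F` at
-- compositions.
indices-blocks : ∀ k d → ∃ λ w → indices k (blocks d) ≡ k ∷ w × bits ℕ._<ᵇ_ k w ≡ d
indices-blocks k []         = [] , refl , refl
indices-blocks k (true ∷ d) with indices-blocks (suc k) d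
... | w , eq , bits≡ = suc k ∷ w , cong (k ∷_) eq , cong₂ _∷_ (<ᵇ-true (ℕ.n<1+n k)) bits≡
indices-blocks k (false ∷ d) with blocks d | blocks-∷ d | indices-blocks k d
... | _ | n , α , refl | w , eq , bits≡ =
  k ∷ w , cong (k ∷_) eq , cong₂ _∷_ (<ᵇ-false (ℕ.≤-refl {k})) bits≡

ascents-comp : ∀ t → ascents (indices 1 (comp t)) ≡ t
ascents-comp nothing  = refl
ascents-comp (just d) with indices-blocks 1 d
... | w , eq , bits≡ = trans (cong ascents eq) (cong just bits≡)

comp-injective : ∀ {s t} → comp s ≡ comp t → s ≡ t
comp-injective {s} {t} eq =
  trans (sym (ascents-comp s)) (trans (cong (ascents ∘ indices 1) eq) (ascents-comp t))

nonzero-comp : ∀ t → nonzeroExponents (comp t) ≡ comp t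
nonzero-comp nothing  = refl
nonzero-comp (just d) = go d
  where
  go : ∀ d → nonzeroExponents (blocks d) ≡ blocks d
  go []          = refl
  go (true  ∷ d) = cong (1 ∷_) (go d)
  go (false ∷ d) with blocks d | blocks-∷ d | go d
  ... | _ | n , α , refl | eq = cong (suc (suc n) ∷_) (List.∷-injectiveʳ eq)

-- A run of `n` false bits makes a block of size `suc n`; the true bit closes it and is absent when
-- no block follows.
prepend : ℕ → Shape → List Bool
prepend zero    nothing  = []
prepend zero    (just d) = true ∷ d
prepend (suc n) s        = false ∷ prepend n s

blocks-prepend : ∀ n s → blocks (prepend n s) ≡ suc n ∷ comp s
blocks-prepend zero    nothing  = refl
blocks-prepend zero    (just d) = refl
blocks-prepend (suc n) s        = cong incrementHead (blocks-prepend n s)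

shapeOf : Monomial → Shape
shapeOf []          = nothing
shapeOf (zero  ∷ a) = shapeOf a
shapeOf (suc n ∷ a) = just (prepend n (shapeOf a))

comp-shapeOf : ∀ a → comp (shapeOf a) ≡ nonzeroExponents a
comp-shapeOf []          = refl
comp-shapeOf (zero  ∷ a) = comp-shapeOf a
comp-shapeOf (suc n ∷ a) = trans (blocks-prepend n (shapeOf a)) (cong (suc n ∷_) (comp-shapeOf a))

coeff-shapeOf : ∀ f a → coeff f a ≡ coeff f (comp (shapeOf a))
coeff-shapeOf f a = quasisymmetric f a (comp (shapeOf a))
  (sym (trans (nonzero-comp (shapeOf a)) (comp-shapeOf a)))

-- Quasisymmetry replaces any exponent list by its nonzero part, which is the composition of some
-- shape.
QSym-ext : ∀ f g → (∀ t → coeff f (comp t) ≡ coeff g (comp t)) → f QSymᴹ.≈ᴹ g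
QSym-ext f g eq a = trans (coeff-shapeOf f a) (trans (eq (shapeOf a)) (sym (coeff-shapeOf g a)))

-- Sums over compositions and the monomial expansion

_≟ᵇ_ : (d e : List Bool) → Dec (d ≡ e)
_≟ᵇ_ = List.≡-dec Bool._≟_

_≟ˢ_ : (s t : Shape) → Dec (s ≡ t)
_≟ˢ_ = Maybe.≡-dec _≟ᵇ_

δ : Shape → Shape → ℚ
δ s t = ⟦ does (s ≟ˢ t) ⟧

coeff-M : ∀ s t → coeff (M (comp s)) (comp t) ≡ δ t s
coeff-M s t = cong ⟦_⟧ (does-⇔
  (mk⇔ (λ eq → comp-injective (trans (sym (nonzero-comp t)) eq))
       (λ eq → trans (nonzero-comp t) (cong comp eq)))
  (List.≡-dec ℕ._≟_ (nonzeroExponents (comp t)) (comp s)) (t ≟ˢ s))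

coeff-F-comp : ∀ s t → coeff (F (comp s)) (comp t) ≡ ⟦ s ≼ t ⟧
coeff-F-comp s t = trans (coeff-F s (comp t)) (cong (λ u → ⟦ s ≼ u ⟧) (ascents-comp t))

bitStrings : ℕ → List (List Bool)
bitStrings zero    = [] ∷ []
bitStrings (suc n) = map (true ∷_) (bitStrings n) ++ map (false ∷_) (bitStrings n)

shapes : ℕ → List Shape
shapes zero    = nothing ∷ []
shapes (suc n) = map just (bitStrings n)

compositions-shapes : ∀ n → compositions n ≡ map comp (shapes n)
compositions-shapes zero    = refl
compositions-shapes (suc n) = trans (go n) (List.map-∘ (bitStrings n))
  where
  go : ∀ n → compositions (suc n) ≡ map blocks (bitStrings n)
  go zero    = refl
  go (suc n) = trans
    (cong₂ _++_
      (trans (cong (map (1 ∷_)) (go n)) (trans (sym (List.map-∘ (bitStrings n))) (List.map-∘ (bitStrings n))))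
      (trans (cong (map incrementHead) (go n)) (trans (sym (List.map-∘ (bitStrings n))) (List.map-∘ (bitStrings n)))))
    (sym (List.map-++ blocks (map (true ∷_) (bitStrings n)) (map (false ∷_) (bitStrings n))))

∑-bitStrings-δ : ∀ n e (g : List Bool → ℚ) →
  ∑ (bitStrings n) (λ d → g d * ⟦ does (e ≟ᵇ d) ⟧) ≡ ⟦ length e ≡ᵇ n ⟧ * g e
∑-bitStrings-δ zero    []      g = trans (ℚ.+-identityʳ _) (ℚ.*-comm (g []) 1ℚ)
∑-bitStrings-δ zero    e@(_ ∷ _) g = trans (ℚ.+-identityʳ _) (trans (ℚ.*-zeroʳ (g [])) (sym (ℚ.*-zeroˡ (g e))))
∑-bitStrings-δ (suc n) e g = trans (∑-++ (map (true ∷_) (bitStrings n)) (map (false ∷_) (bitStrings n)))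
  (trans (cong₂ _+_ (∑-map (true ∷_) (bitStrings n)) (∑-map (false ∷_) (bitStrings n))) (go e))
  where
  none : (h : List Bool → ℚ) → ∑ (bitStrings n) (λ d → h d * 0ℚ) ≡ 0ℚ
  none h = trans (∑-cong (bitStrings n) λ d → ℚ.*-zeroʳ (h d)) (∑-0 (bitStrings n))
  go : ∀ e → ∑ (bitStrings n) (λ d → g (true ∷ d) * ⟦ does (e ≟ᵇ (true ∷ d)) ⟧) +
             ∑ (bitStrings n) (λ d → g (false ∷ d) * ⟦ does (e ≟ᵇ (false ∷ d)) ⟧) ≡
             ⟦ length e ≡ᵇ suc n ⟧ * g e
  go []          = trans (cong₂ _+_ (none (g ∘ (true ∷_))) (none (g ∘ (false ∷_)))) (sym (ℚ.*-zeroˡ (g [])))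
  go (true  ∷ e) = trans (cong₂ _+_ (∑-bitStrings-δ n e (g ∘ (true ∷_))) (none (g ∘ (false ∷_)))) (ℚ.+-identityʳ _)
  go (false ∷ e) = trans (cong₂ _+_ (none (g ∘ (true ∷_))) (∑-bitStrings-δ n e (g ∘ (false ∷_)))) (ℚ.+-identityˡ _)

-- Every shape of size `n` is listed exactly once, so the delta selects the value at `t` or nothing.
∑-shapes-δ : ∀ n t (g : Shape → ℚ) → ∑ (shapes n) (λ s → g s * δ t s) ≡ ⟦ size t ≡ᵇ n ⟧ * g t
∑-shapes-δ zero    nothing  g = trans (ℚ.+-identityʳ _) (ℚ.*-comm (g nothing) 1ℚ)
∑-shapes-δ zero    (just e) g =
  trans (ℚ.+-identityʳ _) (trans (ℚ.*-zeroʳ (g nothing)) (sym (ℚ.*-zeroˡ (g (just e)))))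
∑-shapes-δ (suc n) nothing  g = trans (∑-map just (bitStrings n))
  (trans (trans (∑-cong (bitStrings n) λ d → ℚ.*-zeroʳ (g (just d))) (∑-0 (bitStrings n)))
         (sym (ℚ.*-zeroˡ (g nothing))))
∑-shapes-δ (suc n) (just e) g = trans (∑-map just (bitStrings n)) (∑-bitStrings-δ n e (g ∘ just))

∑-upTo-≡ᵇ : ∀ n m → ∑ (upTo n) (λ i → ⟦ m ≡ᵇ i ⟧) ≡ ⟦ m ℕ.<ᵇ n ⟧
∑-upTo-≡ᵇ zero    m       = refl
∑-upTo-≡ᵇ (suc n) zero    = trans (∑-upTo-suc n (λ i → ⟦ 0 ≡ᵇ i ⟧)) (cong (1ℚ +_) (∑-0 (upTo n)))
∑-upTo-≡ᵇ (suc n) (suc m) = trans (∑-upTo-suc n (λ i → ⟦ suc m ≡ᵇ i ⟧))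
  (trans (ℚ.+-identityˡ _) (∑-upTo-≡ᵇ n m))

compositions≤ : ℕ → List (List ℕ)
compositions≤ N = concatMap compositions (upTo (suc N))

∑-compositions≤ : ∀ N (h : List ℕ → ℚ) →
  ∑ (compositions≤ N) h ≡ ∑ (upTo (suc N)) (λ n → ∑ (shapes n) (h ∘ comp))
∑-compositions≤ N h = trans (∑-concatMap compositions (upTo (suc N)) {h})
  (∑-cong (upTo (suc N)) λ n → trans (cong (λ αs → ∑ αs h) (compositions-shapes n)) (∑-map comp (shapes n)))

∑-shapes≤-δ : ∀ f {N} → degree f ≤ N → ∀ t →
  ∑ (upTo (suc N)) (λ n → ∑ (shapes n) (λ s → coeff f (comp s) * δ t s)) ≡ coeff f (comp t)
∑-shapes≤-δ f {N} deg≤N t = begin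
  ∑ (upTo (suc N)) (λ n → ∑ (shapes n) (λ s → coeff f (comp s) * δ t s))
    ≡⟨ ∑-cong (upTo (suc N)) (λ n → ∑-shapes-δ n t (coeff f ∘ comp)) ⟩
  ∑ (upTo (suc N)) (λ n → ⟦ size t ≡ᵇ n ⟧ * coeff f (comp t))
    ≡⟨ ∑-* (upTo (suc N)) (λ n → ⟦ size t ≡ᵇ n ⟧) (coeff f (comp t)) ⟨
  ∑ (upTo (suc N)) (λ n → ⟦ size t ≡ᵇ n ⟧) * coeff f (comp t)
    ≡⟨ cong (_* coeff f (comp t)) (∑-upTo-≡ᵇ (suc N) (size t)) ⟩
  ⟦ size t ℕ.<ᵇ suc N ⟧ * coeff f (comp t)
    ≡⟨ cut ⟩
  coeff f (comp t) ∎
  where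
  open ≡-Reasoning
  cut : ⟦ size t ℕ.<ᵇ suc N ⟧ * coeff f (comp t) ≡ coeff f (comp t)
  cut with size t ℕ.≤? N
  ... | yes t≤N rewrite <ᵇ-true (s≤s t≤N) = ℚ.*-identityˡ _
  -- A shape too large to be listed has size above the degree bound, where the coefficient of `f`
  -- vanishes anyway.
  ... | no  t≰N = trans (cong (⟦ size t ℕ.<ᵇ suc N ⟧ *_) f≡0) (trans (ℚ.*-zeroʳ ⟦ size t ℕ.<ᵇ suc N ⟧) (sym f≡0))
    where
    f≡0 : coeff f (comp t) ≡ 0ℚ
    f≡0 = bounded f (comp t) (subst (degree f <_) (sym (sum-comp t)) (ℕ.≤-<-trans deg≤N (ℕ.≰⇒> t≰N)))

∑-shapes-vanish : ∀ f {n} → degree f < n → (h : List ℕ → ℚ) → ∑ (shapes n) (λ s → coeff f (comp s) * h (comp s)) ≡ 0ℚ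
∑-shapes-vanish f {n} deg<n h = ∑-zero (All.map
  (λ {s} size≡n → trans (cong (_* h (comp s)) (bounded f (comp s)
    (subst (degree f <_) (sym (trans (sum-comp s) size≡n)) deg<n))) (ℚ.*-zeroˡ (h (comp s))))
  (size-shapes n))
  where
  length-bitStrings : ∀ n → All (λ d → length d ≡ n) (bitStrings n)
  length-bitStrings zero    = refl ∷ []
  length-bitStrings (suc n) = All.++⁺
    (All.map⁺ (All.map (cong suc) (length-bitStrings n))) (All.map⁺ (All.map (cong suc) (length-bitStrings n)))
  size-shapes : ∀ n → All (λ s → size s ≡ n) (shapes n)
  size-shapes zero    = refl ∷ []
  size-shapes (suc n) = All.map⁺ (All.map (cong suc) (length-bitStrings n))

-- Raising the bound above `degree f` adds only levels on which `f` vanishes. This makes functions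
-- with different stored bounds comparable.
∑-compositions≤-stable : ∀ f {N} → degree f ≤ N → (h : List ℕ → ℚ) →
  ∑ (compositions≤ N) (λ α → coeff f α * h α) ≡ ∑ (compositions≤ (degree f)) (λ α → coeff f α * h α)
∑-compositions≤-stable f {N} deg≤N h = trans (∑-compositions≤ N (λ α → coeff f α * h α))
  (trans (go (ℕ.≤⇒≤′ deg≤N)) (sym (∑-compositions≤ (degree f) (λ α → coeff f α * h α))))
  where
  level : ℕ → ℚ
  level n = ∑ (shapes n) (λ s → coeff f (comp s) * h (comp s))
  go : ∀ {N} → degree f ℕ.≤′ N → ∑ (upTo (suc N)) level ≡ ∑ (upTo (suc (degree f))) level
  go (ℕ.≤′-reflexive refl) = refl
  go (ℕ.≤′-step {N} deg≤N) = trans (∑-upTo-last (suc N) level)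
    (trans (cong₂ _+_ (go deg≤N) (∑-shapes-vanish f (s≤s (ℕ.≤′⇒≤ deg≤N)) h)) (ℚ.+-identityʳ _))

monomial-expansion : ∀ f {N} → degree f ≤ N → ∀ a →
  ∑ (compositions≤ N) (λ α → coeff f α * coeff (M α) a) ≡ coeff f a
monomial-expansion f {N} deg≤N a = begin
  ∑ (compositions≤ N) (λ α → coeff f α * coeff (M α) a)
    ≡⟨ ∑-compositions≤ N (λ α → coeff f α * coeff (M α) a) ⟩
  ∑ (upTo (suc N)) (λ n → ∑ (shapes n) (λ s → coeff f (comp s) * coeff (M (comp s)) a))
    ≡⟨ ∑-cong (upTo (suc N)) (λ n → ∑-cong (shapes n) λ s → cong (coeff f (comp s) *_)
         (trans (coeff-shapeOf (M (comp s)) a) (coeff-M s (shapeOf a)))) ⟩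
  ∑ (upTo (suc N)) (λ n → ∑ (shapes n) (λ s → coeff f (comp s) * δ (shapeOf a) s))
    ≡⟨ ∑-shapes≤-δ f deg≤N (shapeOf a) ⟩
  coeff f (comp (shapeOf a))
    ≡⟨ coeff-shapeOf f a ⟨
  coeff f a ∎
  where open ≡-Reasoning

-- Möbius inversion in the refinement order

pairing : List (ℚ × A) → (A → ℚ) → ℚ
pairing l f = ∑ l λ (c , x) → c * f x

pairing-map₂ : (h : A → B) (l : List (ℚ × A)) (f : B → ℚ) → pairing (map (Product.map₂ h) l) f ≡ pairing l (f ∘ h)
pairing-map₂ h l f = ∑-map (Product.map₂ h) l

pairing-neg : (h : A → B) (l : List (ℚ × A)) (f : B → ℚ) → pairing (map (Product.map -_ h) l) f ≡ - pairing l (f ∘ h)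
pairing-neg h l f = trans (∑-map (Product.map -_ h) l)
  (trans (∑-cong l λ (c , x) → sym (ℚ.neg-distribˡ-* c (f (h x)))) (∑-neg l _))

pairing-difference : (h k : A → B) (l : List (ℚ × A)) (f : B → ℚ) →
  pairing (map (Product.map₂ h) l ++ map (Product.map -_ k) l) f ≡ pairing l (f ∘ h) + - pairing l (f ∘ k)
pairing-difference h k l f = trans (∑-++ (map (Product.map₂ h) l) _)
  (cong₂ _+_ (pairing-map₂ h l f) (pairing-neg k l f))

pairing-0 : (l : List (ℚ × A)) → pairing l (λ _ → 0ℚ) ≡ 0ℚ
pairing-0 l = trans (∑-cong l λ (c , _) → ℚ.*-zeroʳ c) (∑-0 l)

coarsenings : List Bool → List (List Bool)
coarsenings []          = [] ∷ []
coarsenings (true  ∷ e) = map (true ∷_) (coarsenings e) ++ map (false ∷_) (coarsenings e)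
coarsenings (false ∷ e) = map (false ∷_) (coarsenings e)

∑-coarsenings : ∀ d e → ∑ (coarsenings e) (λ c → ⟦ does (d ≟ᵇ c) ⟧) ≡ ⟦ d ≼ᵇ e ⟧
∑-coarsenings []      []         = refl
∑-coarsenings (_ ∷ _) []         = refl
∑-coarsenings d       (true ∷ e) = trans (∑-++ (map (true ∷_) (coarsenings e)) _)
  (trans (cong₂ _+_ (∑-map (true ∷_) (coarsenings e)) (∑-map (false ∷_) (coarsenings e))) (go d))
  where
  go : ∀ d → ∑ (coarsenings e) (λ c → ⟦ does (d ≟ᵇ (true ∷ c)) ⟧) +
             ∑ (coarsenings e) (λ c → ⟦ does (d ≟ᵇ (false ∷ c)) ⟧) ≡ ⟦ d ≼ᵇ (true ∷ e) ⟧
  go []          = cong₂ _+_ (∑-0 (coarsenings e)) (∑-0 (coarsenings e))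
  go (true  ∷ d) = trans (cong₂ _+_ (∑-coarsenings d e) (∑-0 (coarsenings e))) (ℚ.+-identityʳ _)
  go (false ∷ d) = trans (cong₂ _+_ (∑-0 (coarsenings e)) (∑-coarsenings d e)) (ℚ.+-identityˡ _)
∑-coarsenings d (false ∷ e) = trans (∑-map (false ∷_) (coarsenings e)) (go d)
  where
  go : ∀ d → ∑ (coarsenings e) (λ c → ⟦ does (d ≟ᵇ (false ∷ c)) ⟧) ≡ ⟦ d ≼ᵇ (false ∷ e) ⟧
  go []          = ∑-0 (coarsenings e)
  go (true  ∷ d) = ∑-0 (coarsenings e)
  go (false ∷ d) = ∑-coarsenings d e

coarserShapes : Shape → List Shape
coarserShapes nothing  = nothing ∷ []
coarserShapes (just e) = map just (coarsenings e)

-- Writes the refinement test as a sum of deltas. Deltas are what the coefficients of descent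
-- classes detect, and `Φ-cong` relies on this.
∑-coarserShapes : ∀ s t → ∑ (coarserShapes t) (δ s) ≡ ⟦ s ≼ t ⟧
∑-coarserShapes nothing  nothing  = refl
∑-coarserShapes (just d) nothing  = refl
∑-coarserShapes nothing  (just e) = trans (∑-map just (coarsenings e)) (∑-0 (coarsenings e))
∑-coarserShapes (just d) (just e) = trans (∑-map just (coarsenings e)) (∑-coarsenings d e)

-- Subsets of the marks of `e`, signed by the parity of the number of marks removed. They recover
-- the coefficient of one class from the values of `Φ x`, whence injectivity.
möbiusBelow : List Bool → List (ℚ × List Bool)
möbiusBelow []          = (1ℚ , []) ∷ []
möbiusBelow (true  ∷ e) = map (Product.map₂ (true ∷_)) (möbiusBelow e) ++ map (Product.map -_ (false ∷_)) (möbiusBelow e)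
möbiusBelow (false ∷ e) = map (Product.map₂ (false ∷_)) (möbiusBelow e)

pairing-möbiusBelow : ∀ d e → pairing (möbiusBelow e) (λ c → ⟦ d ≼ᵇ c ⟧) ≡ ⟦ does (d ≟ᵇ e) ⟧
pairing-möbiusBelow []      []         = refl
pairing-möbiusBelow (_ ∷ _) []         = refl
pairing-möbiusBelow d       (true ∷ e) = trans (pairing-difference (true ∷_) (false ∷_) (möbiusBelow e) _) (go d)
  where
  go : ∀ d → pairing (möbiusBelow e) (λ c → ⟦ d ≼ᵇ (true ∷ c) ⟧) + - pairing (möbiusBelow e) (λ c → ⟦ d ≼ᵇ (false ∷ c) ⟧)
    ≡ ⟦ does (d ≟ᵇ (true ∷ e)) ⟧
  go []          = cong₂ (λ p q → p + - q) (pairing-0 (möbiusBelow e)) (pairing-0 (möbiusBelow e))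
  go (true  ∷ d) = trans (cong₂ (λ p q → p + - q) (pairing-möbiusBelow d e) (pairing-0 (möbiusBelow e))) (ℚ.+-identityʳ _)
  -- A mark of the upper set that `d` lacks may be kept or removed, and the two choices cancel.
  go (false ∷ d) = ℚ.+-inverseʳ (pairing (möbiusBelow e) (λ c → ⟦ d ≼ᵇ c ⟧))
pairing-möbiusBelow d (false ∷ e) = trans (pairing-map₂ (false ∷_) (möbiusBelow e) _) (go d)
  where
  go : ∀ d → pairing (möbiusBelow e) (λ c → ⟦ d ≼ᵇ (false ∷ c) ⟧) ≡ ⟦ does (d ≟ᵇ (false ∷ e)) ⟧
  go []          = pairing-0 (möbiusBelow e)
  go (true  ∷ d) = pairing-0 (möbiusBelow e)
  go (false ∷ d) = pairing-möbiusBelow d e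

möbiusBelowˢ : Shape → List (ℚ × Shape)
möbiusBelowˢ nothing  = (1ℚ , nothing) ∷ []
möbiusBelowˢ (just e) = map (Product.map₂ just) (möbiusBelow e)

pairing-möbiusBelowˢ : ∀ s t → pairing (möbiusBelowˢ t) (λ u → ⟦ s ≼ u ⟧) ≡ δ s t
pairing-möbiusBelowˢ nothing  nothing  = refl
pairing-möbiusBelowˢ (just d) nothing  = refl
pairing-möbiusBelowˢ nothing  (just e) = trans (pairing-map₂ just (möbiusBelow e) _) (pairing-0 (möbiusBelow e))
pairing-möbiusBelowˢ (just d) (just e) = trans (pairing-map₂ just (möbiusBelow e) _) (pairing-möbiusBelow d e)

-- Supersets of the marks of `d`, signed by the parity of the number of marks added: the expansion
-- of a monomial function in the fundamental basis, whence surjectivity.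
möbiusAbove : List Bool → List (ℚ × List Bool)
möbiusAbove []          = (1ℚ , []) ∷ []
möbiusAbove (true  ∷ d) = map (Product.map₂ (true ∷_)) (möbiusAbove d)
möbiusAbove (false ∷ d) = map (Product.map₂ (false ∷_)) (möbiusAbove d) ++ map (Product.map -_ (true ∷_)) (möbiusAbove d)

pairing-möbiusAbove : ∀ d e → pairing (möbiusAbove d) (λ c → ⟦ c ≼ᵇ e ⟧) ≡ ⟦ does (e ≟ᵇ d) ⟧
pairing-möbiusAbove []         []      = refl
pairing-möbiusAbove []         (_ ∷ _) = refl
pairing-möbiusAbove (true ∷ d) e       = trans (pairing-map₂ (true ∷_) (möbiusAbove d) _) (go e)
  where
  go : ∀ e → pairing (möbiusAbove d) (λ c → ⟦ (true ∷ c) ≼ᵇ e ⟧) ≡ ⟦ does (e ≟ᵇ (true ∷ d)) ⟧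
  go []          = pairing-0 (möbiusAbove d)
  go (true  ∷ e) = pairing-möbiusAbove d e
  go (false ∷ e) = pairing-0 (möbiusAbove d)
pairing-möbiusAbove (false ∷ d) e = trans (pairing-difference (false ∷_) (true ∷_) (möbiusAbove d) _) (go e)
  where
  go : ∀ e → pairing (möbiusAbove d) (λ c → ⟦ (false ∷ c) ≼ᵇ e ⟧) + - pairing (möbiusAbove d) (λ c → ⟦ (true ∷ c) ≼ᵇ e ⟧)
    ≡ ⟦ does (e ≟ᵇ (false ∷ d)) ⟧
  go []          = cong₂ (λ p q → p + - q) (pairing-0 (möbiusAbove d)) (pairing-0 (möbiusAbove d))
  go (true  ∷ e) = ℚ.+-inverseʳ (pairing (möbiusAbove d) (λ c → ⟦ c ≼ᵇ e ⟧))
  go (false ∷ e) = trans (cong₂ (λ p q → p + - q) (pairing-möbiusAbove d e) (pairing-0 (möbiusAbove d))) (ℚ.+-identityʳ _)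

möbiusAboveˢ : Shape → List (ℚ × Shape)
möbiusAboveˢ nothing  = (1ℚ , nothing) ∷ []
möbiusAboveˢ (just d) = map (Product.map₂ just) (möbiusAbove d)

pairing-möbiusAboveˢ : ∀ s t → pairing (möbiusAboveˢ s) (λ u → ⟦ u ≼ t ⟧) ≡ δ t s
pairing-möbiusAboveˢ nothing  nothing  = refl
pairing-möbiusAboveˢ nothing  (just e) = refl
pairing-möbiusAboveˢ (just d) nothing  = trans (pairing-map₂ just (möbiusAbove d) _) (pairing-0 (möbiusAbove d))
pairing-möbiusAboveˢ (just d) (just e) = trans (pairing-map₂ just (möbiusAbove d) _) (pairing-möbiusAbove d e)

-- Permutations with prescribed descents

-- The letters used are `1` to `suc (length d)`. A descent is created by prepending a new maximum,
-- an ascent by prepending a new minimum below the shifted tail; neither disturbs the later bits.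
word : List Bool → List ℕ
word []          = 1 ∷ []
word (true  ∷ d) = suc (suc (length d)) ∷ word d
word (false ∷ d) = 1 ∷ map suc (word d)

word-bounds : ∀ d → All (λ x → 0 < x × x ≤ suc (length d)) (word d)
word-bounds []          = (s≤s z≤n , s≤s z≤n) ∷ []
word-bounds (true  ∷ d) = (s≤s z≤n , ℕ.≤-refl) ∷
  All.map (λ (0<x , x≤) → 0<x , ℕ.m≤n⇒m≤1+n x≤) (word-bounds d)
word-bounds (false ∷ d) = (s≤s z≤n , s≤s z≤n) ∷
  All.map⁺ (All.map (λ (0<x , x≤) → s≤s z≤n , s≤s x≤) (word-bounds d))

word-unique : ∀ d → Unique (word d)
word-unique []          = [] ∷ []
word-unique (true  ∷ d) =
  All.map (λ (_ , x≤) eq → ℕ.<-irrefl (sym eq) (s≤s x≤)) (word-bounds d) ∷ word-unique d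
word-unique (false ∷ d) =
  All.map⁺ (All.map (λ (0<x , _) eq → ℕ.<-irrefl (ℕ.suc-injective eq) 0<x) (word-bounds d)) ∷
  Unique.map⁺ ℕ.suc-injective (word-unique d)

bits-map-suc : ∀ x w → bits (λ x y → y ℕ.<ᵇ x) (suc x) (map suc w) ≡ bits (λ x y → y ℕ.<ᵇ x) x w
bits-map-suc x []      = refl
bits-map-suc x (y ∷ w) = cong ((y ℕ.<ᵇ x) ∷_) (bits-map-suc y w)

descents-word : ∀ d → descents (word d) ≡ just d
descents-word []         = refl
descents-word (true ∷ d) with word d | word-bounds d | descents-word d
... | x ∷ w | (_ , x≤) ∷ _ | eq = cong just (cong₂ _∷_ (<ᵇ-true (s≤s x≤)) (Maybe.just-injective eq))
descents-word (false ∷ d) with word d | descents-word d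
... | x ∷ w | eq = cong just (cong (false ∷_) (trans (bits-map-suc x w) (Maybe.just-injective eq)))

permOf : Shape → Perm
permOf nothing  = ∅
permOf (just d) = perm (word d) (All.map proj₁ (word-bounds d)) (word-unique d)

descents-permOf : ∀ s → descents (letters (permOf s)) ≡ s
descents-permOf nothing  = refl
descents-permOf (just d) = descents-word d

Comp-cong : ∀ π σ → π ∼ σ → Comp π ≡ Comp σ
Comp-cong (perm []      _ _) (perm []      _ _) _           = refl
Comp-cong (perm (_ ∷ _) _ _) (perm (_ ∷ _) _ _) (len , des) = cong₂ (gaps 0) des len

∼⇒descents : ∀ π σ → π ∼ σ → descents (letters π) ≡ descents (letters σ)
∼⇒descents π σ π∼σ = comp-injective
  (trans (sym (Comp-descents π)) (trans (Comp-cong π σ π∼σ) (Comp-descents σ)))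

descents⇒∼ : ∀ π σ → descents (letters π) ≡ descents (letters σ) → π ∼ σ
descents⇒∼ π σ eq =
  trans (sym (size-shape _ (letters π))) (trans (cong size eq) (size-shape _ (letters σ))) ,
  trans (Des-descents (letters π)) (trans (cong markedˢ eq) (sym (Des-descents (letters σ))))
  where
  markedˢ : Shape → List ℕ
  markedˢ nothing  = []
  markedˢ (just d) = marked d
  Des-descents : ∀ w → positions ℕ._>?_ w ≡ markedˢ (descents w)
  Des-descents []      = refl
  Des-descents (x ∷ w) = positions-marked ℕ._>?_ x w

-- The linear isomorphism

coefficient-δ : ∀ x σ →
  coefficient x σ ≡ ∑ x (λ (q , π) → q * δ (descents (letters π)) (descents (letters σ)))
coefficient-δ []            σ = refl
coefficient-δ ((q , π) ∷ x) σ = cong₂ _+_ (trans (if-* (does (π ∼? σ)))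
  (cong (λ b → q * ⟦ b ⟧) (does-⇔ (mk⇔ (∼⇒descents π σ) (descents⇒∼ π σ)) (π ∼? σ) (_ ≟ˢ _))))
  (coefficient-δ x σ)
  where
  if-* : ∀ b → (if b then q else 0ℚ) ≡ q * ⟦ b ⟧
  if-* true  = sym (ℚ.*-identityʳ q)
  if-* false = sym (ℚ.*-zeroʳ q)

coeff-sumᵠ : (h : A → QSymCarrier) (xs : List A) → ∀ a → coeff (sumᵠ (map h xs)) a ≡ ∑ xs (λ x → coeff (h x) a)
coeff-sumᵠ h []       a = refl
coeff-sumᵠ h (x ∷ xs) a = cong (coeff (h x) a +_) (coeff-sumᵠ h xs a)

coeff-Φ : ∀ x a → coeff (Φ x) a ≡ ∑ x (λ (q , π) → q * coeff (F (Comp π)) a)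
coeff-Φ = coeff-sumᵠ (λ (q , π) → q QSymᴹ.*ₗ F (Comp π))

coeff-Φ-comp : ∀ x t → coeff (Φ x) (comp t) ≡ ∑ x (λ (q , π) → q * ⟦ descents (letters π) ≼ t ⟧)
coeff-Φ-comp x t = trans (coeff-Φ x (comp t)) (∑-cong x λ (q , π) → cong (q *_)
  (trans (cong (λ α → coeff (F α) (comp t)) (Comp-descents π)) (coeff-F-comp (descents (letters π)) t)))

-- The value of `Φ x` at a composition is the sum of the coefficients of `x` over all coarser
-- classes, so it depends only on these coefficients.
Φ-cong : ∀ x y → (∀ σ → coefficient x σ ≡ coefficient y σ) → Φ x QSymᴹ.≈ᴹ Φ y
Φ-cong x y x≈y = QSym-ext (Φ x) (Φ y) λ t →
  trans (expand x t) (trans (∑-cong (coarserShapes t) λ s → x≈y (permOf s)) (sym (expand y t)))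
  where
  expand : ∀ x t → coeff (Φ x) (comp t) ≡ ∑ (coarserShapes t) (coefficient x ∘ permOf)
  expand x t = trans (coeff-Φ-comp x t)
    (trans (∑-cong x λ (q , π) → trans (cong (q *_) (sym (∑-coarserShapes (descents (letters π)) t)))
                                       (*-∑ q (coarserShapes t) _))
    (trans (∑-swap x (coarserShapes t) (λ (q , π) s → q * δ (descents (letters π)) s))
           (∑-cong (coarserShapes t) λ s → sym (trans (coefficient-δ x (permOf s))
             (∑-cong x λ (q , π) → cong (λ u → q * δ (descents (letters π)) u) (descents-permOf s))))))

-- Möbius inversion expresses each class coefficient as a signed sum of values of `Φ x`.
Φ-injective : ∀ x y → Φ x QSymᴹ.≈ᴹ Φ y → ∀ σ → coefficient x σ ≡ coefficient y σ
Φ-injective x y Φx≈Φy σ = trans (expand x)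
  (trans (∑-cong (möbiusBelowˢ (descents (letters σ))) λ (c , t) → cong (c *_) (Φx≈Φy (comp t))) (sym (expand y)))
  where
  μ = möbiusBelowˢ (descents (letters σ))
  expand : ∀ x → coefficient x σ ≡ pairing μ (coeff (Φ x) ∘ comp)
  expand x = trans (coefficient-δ x σ)
    (trans (∑-cong x λ (q , π) → trans
             (cong (q *_) (sym (pairing-möbiusBelowˢ (descents (letters π)) (descents (letters σ)))))
             (*-∑ q μ _))
    (trans (∑-swap x μ (λ (q , π) (c , t) → q * (c * ⟦ descents (letters π) ≼ t ⟧)))
           (∑-cong μ λ (c , t) → trans (∑-cong x λ (q , π) → *-swap q c ⟦ descents (letters π) ≼ t ⟧)
             (trans (sym (*-∑ c x _)) (cong (c *_) (sym (coeff-Φ-comp x t)))))))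

-- Expands `f` in the monomial basis, each monomial function in the fundamental basis by
-- `möbiusAboveˢ`, and realises each fundamental function by a permutation with the required
-- descents.
Φ⁻¹ : QSymCarrier → HCarrier
Φ⁻¹ f = concatMap (λ n → concatMap (λ s → map (λ (c , t) → coeff f (comp s) * c , permOf t) (möbiusAboveˢ s)) (shapes n))
  (upTo (suc (degree f)))

Φ-Φ⁻¹ : ∀ f → Φ (Φ⁻¹ f) QSymᴹ.≈ᴹ f
Φ-Φ⁻¹ f = QSym-ext (Φ (Φ⁻¹ f)) f λ t → begin
  coeff (Φ (Φ⁻¹ f)) (comp t)
    ≡⟨ coeff-Φ-comp (Φ⁻¹ f) t ⟩
  ∑ (Φ⁻¹ f) (λ (q , π) → q * ⟦ descents (letters π) ≼ t ⟧)
    ≡⟨ ∑-concatMap (λ n → concatMap term (shapes n)) (upTo (suc (degree f)))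
         {λ (q , π) → q * ⟦ descents (letters π) ≼ t ⟧} ⟩
  ∑ (upTo (suc (degree f))) (λ n → ∑ (concatMap term (shapes n)) (λ (q , π) → q * ⟦ descents (letters π) ≼ t ⟧))
    ≡⟨ ∑-cong (upTo (suc (degree f))) (λ n → trans (∑-concatMap term (shapes n)) (∑-cong (shapes n) (term-δ t))) ⟩
  ∑ (upTo (suc (degree f))) (λ n → ∑ (shapes n) (λ s → coeff f (comp s) * δ t s))
    ≡⟨ ∑-shapes≤-δ f ℕ.≤-refl t ⟩
  coeff f (comp t) ∎
  where
  open ≡-Reasoning
  term : Shape → HCarrier
  term s = map (λ (c , t) → coeff f (comp s) * c , permOf t) (möbiusAboveˢ s)
  term-δ : ∀ t s → ∑ (term s) (λ (q , π) → q * ⟦ descents (letters π) ≼ t ⟧) ≡ coeff f (comp s) * δ t s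
  term-δ t s = trans (∑-map (λ (c , t) → coeff f (comp s) * c , permOf t) (möbiusAboveˢ s))
    (trans (∑-cong (möbiusAboveˢ s) λ (c , u) → trans
             (cong (λ v → coeff f (comp s) * c * ⟦ v ≼ t ⟧) (descents-permOf u))
             (ℚ.*-assoc (coeff f (comp s)) c ⟦ u ≼ t ⟧))
    (trans (sym (*-∑ (coeff f (comp s)) (möbiusAboveˢ s) _))
           (cong (coeff f (comp s) *_) (pairing-möbiusAboveˢ s t))))

open RawLeftModule H-Module using () renaming (-ᴹ_ to -ᴴ_)

Φ-++ : ∀ x y → Φ (x ++ y) QSymᴹ.≈ᴹ (Φ x QSymᴹ.+ᴹ Φ y)
Φ-++ x y a = trans (coeff-Φ (x ++ y) a)
  (trans (∑-++ x y) (sym (cong₂ _+_ (coeff-Φ x a) (coeff-Φ y a))))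

Φ-scale : ∀ q x → Φ (scaleᴴ q x) QSymᴹ.≈ᴹ (q QSymᴹ.*ₗ Φ x)
Φ-scale q x a = trans (coeff-Φ (scaleᴴ q x) a)
  (trans (∑-map (Product.map₁ (q *_)) x)
  (trans (∑-cong x λ (r , π) → ℚ.*-assoc q r (coeff (F (Comp π)) a))
  (trans (sym (*-∑ q x _)) (cong (q *_) (sym (coeff-Φ x a))))))

Φ-neg : ∀ x → Φ (-ᴴ x) QSymᴹ.≈ᴹ (QSymᴹ.-ᴹ Φ x)
Φ-neg x a = trans (coeff-Φ (-ᴴ x) a)
  (trans (∑-map (Product.map₁ -_) x)
  (trans (∑-cong x λ (r , π) → sym (ℚ.neg-distribˡ-* r (coeff (F (Comp π)) a)))
  (trans (∑-neg x _) (cong -_ (sym (coeff-Φ x a))))))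

open LeftModuleMorphisms H-Module QSym-Module using (IsLeftModuleIsomorphism)

Φ-isLeftModuleIsomorphism : IsLeftModuleIsomorphism Φ
Φ-isLeftModuleIsomorphism = record
  { isLeftModuleMonomorphism = record
    { isLeftModuleHomomorphism = record
      { +ᴹ-isGroupHomomorphism = record
        { isMonoidHomomorphism = record
          { isMagmaHomomorphism = record
            { isRelHomomorphism = record { cong = λ {x} {y} → Φ-cong x y }
            ; homo = Φ-++
            }
          ; ε-homo = λ _ → refl
          }
        ; ⁻¹-homo = Φ-neg
        }
      ; *ₗ-homo = Φ-scale
      }
    ; injective = λ {x} {y} → Φ-injective x y
    }
  ; surjective = λ f → Φ⁻¹ f , λ {x} x≈ a → trans (Φ-cong x (Φ⁻¹ f) x≈ a) (Φ-Φ⁻¹ f a)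
  }

-- Products, unit and counit

mulCoeff-cong : ∀ {f f′ g g′ : Monomial → ℚ} → (∀ b → f b ≡ f′ b) → (∀ c → g c ≡ g′ c) →
  ∀ a → mulCoeff f g a ≡ mulCoeff f′ g′ a
mulCoeff-cong f≗ g≗ a = ∑-cong (factorisations a) λ (b , c) → cong₂ _*_ (f≗ b) (g≗ c)

mulCoeff-∑ : (xs : List A) (ys : List B) (f : A → Monomial → ℚ) (g : B → Monomial → ℚ) → ∀ a →
  mulCoeff (λ b → ∑ xs (λ x → f x b)) (λ c → ∑ ys (λ y → g y c)) a ≡
  ∑ xs (λ x → ∑ ys (λ y → mulCoeff (f x) (g y) a))
mulCoeff-∑ xs ys f g a = trans
  (∑-cong (factorisations a) λ (b , c) → sym (∑-product xs ys (λ x → f x b) (λ y → g y c)))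
  (trans (∑-swap (factorisations a) xs _)
         (∑-cong xs λ x → ∑-swap (factorisations a) ys _))

mulCoeff-scale : ∀ q r (f g : Monomial → ℚ) a →
  mulCoeff (λ b → q * f b) (λ c → r * g c) a ≡ (q * r) * mulCoeff f g a
mulCoeff-scale q r f g a = trans
  (∑-cong (factorisations a) λ (b , c) → *-interchange q (f b) r (g c))
  (sym (*-∑ (q * r) (factorisations a) _))

∑-reduce : ∀ {P : A → Set} (f : ∀ {x} → P x → B) {xs} (ps : All P xs) {g : B → ℚ} {h : A → ℚ} →
  (∀ {x} (p : P x) → g (f p) ≡ h x) → ∑ (All.reduce f ps) g ≡ ∑ xs h
∑-reduce f []       eq = refl
∑-reduce f (p ∷ ps) eq = cong₂ _+_ (eq p) (∑-reduce f ps eq)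

∑-shuffle : ∀ π σ (d : Disjoint (letters π) (letters σ)) (h : List ℕ → ℚ) →
  ∑ (shuffle π σ d) (h ∘ letters) ≡ ∑ (shuffles (letters π) (letters σ)) h
∑-shuffle π σ d h = ∑-reduce _ (shuffles-↭ (letters π) (letters σ)) (λ _ → refl)

module _ (reps : Representatives) where

  -- The shuffle identity applies to the letters of the chosen representatives; their choice then
  -- disappears, since equivalent permutations have the same `Comp`.
  ∑-shuffleSet : ∀ π σ a →
    ∑ (DisjointRepresentatives.shuffleSet (reps π σ)) (λ τ → coeff (F (Comp τ)) a) ≡
    mulCoeff (coeff (F (Comp π))) (coeff (F (Comp σ))) a
  ∑-shuffleSet π σ a = begin
    ∑ (shuffle π′ σ′ disjoint) (λ τ → coeff (F (Comp τ)) a)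
      ≡⟨ ∑-cong (shuffle π′ σ′ disjoint) (λ τ → coeff-F-Comp τ a) ⟩
    ∑ (shuffle π′ σ′ disjoint) (λ τ → fundamental (letters τ) a)
      ≡⟨ ∑-shuffle π′ σ′ disjoint (λ w → fundamental w a) ⟩
    ∑ (shuffles (letters π′) (letters σ′)) (λ w → fundamental w a)
      ≡⟨ fundamental-shuffles a (letters π′) (letters σ′) disjoint ⟩
    mulCoeff (fundamental (letters π′)) (fundamental (letters σ′)) a
      ≡⟨ mulCoeff-cong
           (λ b → trans (sym (coeff-F-Comp π′ b)) (cong (λ α → coeff (F α) b) (Comp-cong π′ π π′∼π)))
           (λ c → trans (sym (coeff-F-Comp σ′ c)) (cong (λ α → coeff (F α) c) (Comp-cong σ′ σ σ′∼σ))) a ⟩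
    mulCoeff (coeff (F (Comp π))) (coeff (F (Comp σ))) a ∎
    where
    open ≡-Reasoning
    open DisjointRepresentatives (reps π σ)

  Φ-* : ∀ x y → Φ (mulᴴ reps x y) QSymᴹ.≈ᴹ (Φ x *ᵠ Φ y)
  Φ-* x y a = begin
    coeff (Φ (mulᴴ reps x y)) a
      ≡⟨ coeff-Φ (mulᴴ reps x y) a ⟩
    ∑ (mulᴴ reps x y) F′
      ≡⟨ ∑-concatMap _ x {F′} ⟩
    ∑ x (λ (q , π) → ∑ (concatMap (λ (r , σ) → map (q * r ,_) (shuffleSet π σ)) y) F′)
      ≡⟨ ∑-cong x (λ (q , π) → trans (∑-concatMap _ y {F′})
           (∑-cong y λ (r , σ) → trans (∑-map (q * r ,_) (shuffleSet π σ))
             (trans (sym (*-∑ (q * r) (shuffleSet π σ) _)) (cong (q * r *_) (∑-shuffleSet π σ a))))) ⟩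
    ∑ x (λ (q , π) → ∑ y (λ (r , σ) → q * r * mulCoeff (coeff (F (Comp π))) (coeff (F (Comp σ))) a))
      ≡⟨ ∑-cong x (λ (q , π) → ∑-cong y λ (r , σ) →
           sym (mulCoeff-scale q r (coeff (F (Comp π))) (coeff (F (Comp σ))) a)) ⟩
    ∑ x (λ (q , π) → ∑ y (λ (r , σ) → mulCoeff (λ b → q * coeff (F (Comp π)) b) (λ c → r * coeff (F (Comp σ)) c) a))
      ≡⟨ mulCoeff-∑ x y (λ (q , π) b → q * coeff (F (Comp π)) b) (λ (r , σ) c → r * coeff (F (Comp σ)) c) a ⟨
    mulCoeff (λ b → ∑ x (λ (q , π) → q * coeff (F (Comp π)) b)) (λ c → ∑ y (λ (r , σ) → r * coeff (F (Comp σ)) c)) a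
      ≡⟨ mulCoeff-cong (coeff-Φ x) (coeff-Φ y) a ⟨
    mulCoeff (coeff (Φ x)) (coeff (Φ y)) a ∎
    where
    open ≡-Reasoning
    shuffleSet : ∀ π σ → List Perm
    shuffleSet π σ = DisjointRepresentatives.shuffleSet (reps π σ)
    F′ : ℚ × Perm → ℚ
    F′ (q , π) = q * coeff (F (Comp π)) a

Φ-[] : ∀ π → Φ [ π ] QSymᴹ.≈ᴹ F (Comp π)
Φ-[] π a = trans (ℚ.+-identityʳ _) (ℚ.*-identityˡ _)

Φ-1 : Φ [ ∅ ] QSymᴹ.≈ᴹ M []
Φ-1 = QSym-ext (Φ [ ∅ ]) (M []) λ t → trans (Φ-[] ∅ (comp t)) (trans (coeff-F-comp nothing t)
  (trans (go t) (sym (coeff-M nothing t))))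
  where
  go : ∀ t → ⟦ nothing ≼ t ⟧ ≡ δ t nothing
  go nothing  = refl
  go (just _) = refl

Φ-ε : ∀ x → coefficient x ∅ ≡ coeff (Φ x) []
Φ-ε x = trans (coefficient-δ x ∅) (trans
  (∑-cong x λ (q , π) → cong (q *_) (go (descents (letters π)))) (sym (coeff-Φ-comp x nothing)))
  where
  go : ∀ s → δ s nothing ≡ ⟦ s ≼ nothing ⟧
  go nothing  = refl
  go (just _) = refl

-- Tensors of quasisymmetric functions

module T = Tensor QSym-Module QSym-Module
open T using (_⊗_; ≈-refl; ≈-sym; ≈-trans; ++-cong; ++-comm; ⊗-cong; distribʳ; distribˡ; zeroˡ; zeroʳ; balanced)

≈-reflexive : ∀ {s t} → s ≡ t → s T.≈ t
≈-reflexive refl = ≈-refl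

++-interchange : ∀ s t u v → (s ++ t) ++ (u ++ v) T.≈ (s ++ u) ++ (t ++ v)
++-interchange s t u v = ≈-trans (≈-reflexive (List.++-assoc s t (u ++ v)))
  (≈-trans (++-cong (≈-refl {s}) (≈-trans (≈-reflexive (sym (List.++-assoc t u v)))
    (≈-trans (++-cong (++-comm t u) (≈-refl {v})) (≈-reflexive (List.++-assoc u t v)))))
  (≈-reflexive (sym (List.++-assoc s u (t ++ v)))))

concatMap-cong : {h k : A → T.Carrier} (xs : List A) → (∀ x → h x T.≈ k x) → concatMap h xs T.≈ concatMap k xs
concatMap-cong []       h≈k = ≈-refl
concatMap-cong (x ∷ xs) h≈k = ++-cong (h≈k x) (concatMap-cong xs h≈k)

concatMap-++ : (h k : A → T.Carrier) (xs : List A) →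
  concatMap (λ x → h x ++ k x) xs T.≈ concatMap h xs ++ concatMap k xs
concatMap-++ h k []       = ≈-refl
concatMap-++ h k (x ∷ xs) = ≈-trans (++-cong (≈-refl {h x ++ k x}) (concatMap-++ h k xs))
  (++-interchange (h x) (k x) (concatMap h xs) (concatMap k xs))

concatMap-[] : {h : A → T.Carrier} (xs : List A) → (∀ x → h x T.≈ []) → concatMap h xs T.≈ []
concatMap-[] []       h≈[] = ≈-refl
concatMap-[] (x ∷ xs) h≈[] = ++-cong (h≈[] x) (concatMap-[] xs h≈[])

sumᵠ-⊗ : (h : A → QSymCarrier) (xs : List A) (g : QSymCarrier) →
  sumᵠ (map h xs) ⊗ g T.≈ concatMap (λ x → h x ⊗ g) xs
sumᵠ-⊗ h []       g = zeroˡ g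
sumᵠ-⊗ h (x ∷ xs) g = ≈-trans (distribʳ (h x) (sumᵠ (map h xs)) g) (++-cong (≈-refl {h x ⊗ g}) (sumᵠ-⊗ h xs g))

⊗-sumᵠ : (f : QSymCarrier) (h : A → QSymCarrier) (xs : List A) →
  f ⊗ sumᵠ (map h xs) T.≈ concatMap (λ x → f ⊗ h x) xs
⊗-sumᵠ f h []       = zeroʳ f
⊗-sumᵠ f h (x ∷ xs) = ≈-trans (distribˡ f (h x) (sumᵠ (map h xs))) (++-cong (≈-refl {f ⊗ h x}) (⊗-sumᵠ f h xs))

-- Normal forms of tensors

monomial-sum : ∀ f {N} → degree f ≤ N →
  f QSymᴹ.≈ᴹ sumᵠ (map (λ α → coeff f α QSymᴹ.*ₗ M α) (compositions≤ N))
monomial-sum f {N} deg≤N a = sym (trans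
  (coeff-sumᵠ (λ α → coeff f α QSymᴹ.*ₗ M α) (compositions≤ N) a) (monomial-expansion f deg≤N a))

bicoeff : T.Carrier → Monomial → Monomial → ℚ
bicoeff t β γ = ∑ t λ (f , g) → coeff f β * coeff g γ

monomialTensor : ℚ → List ℕ → List ℕ → T.Carrier
monomialTensor c α β = (c QSymᴹ.*ₗ M α) ⊗ M β

monomialTensor-+ : ∀ c d α β → monomialTensor (c + d) α β T.≈ monomialTensor c α β ++ monomialTensor d α β
monomialTensor-+ c d α β = ≈-trans
  (⊗-cong (λ a → ℚ.*-distribʳ-+ (coeff (M α) a) c d) (λ _ → refl))
  (distribʳ (c QSymᴹ.*ₗ M α) (d QSymᴹ.*ₗ M α) (M β))

-- Depends on a tensor only through a function of pairs and a bound, so tensors with equal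
-- coefficients are rewritten to the same expression.
normalForm : ℕ → (Monomial → Monomial → ℚ) → T.Carrier
normalForm N c = concatMap (λ α → concatMap (λ β → monomialTensor (c α β) α β) (compositions≤ N)) (compositions≤ N)

normalForm-cong : ∀ N {c d} → (∀ α β → c α β ≡ d α β) → normalForm N c T.≈ normalForm N d
normalForm-cong N eq = concatMap-cong (compositions≤ N) λ α → concatMap-cong (compositions≤ N) λ β →
  ⊗-cong (λ a → cong (_* coeff (M α) a) (eq α β)) (λ _ → refl)

normalForm-+ : ∀ N c d → normalForm N (λ α β → c α β + d α β) T.≈ normalForm N c ++ normalForm N d
normalForm-+ N c d = ≈-trans
  (concatMap-cong (compositions≤ N) λ α → ≈-trans
    (concatMap-cong (compositions≤ N) λ β → monomialTensor-+ (c α β) (d α β) α β)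
    (concatMap-++ (λ β → monomialTensor (c α β) α β) (λ β → monomialTensor (d α β) α β) (compositions≤ N)))
  (concatMap-++ (λ α → concatMap (λ β → monomialTensor (c α β) α β) (compositions≤ N))
                (λ α → concatMap (λ β → monomialTensor (d α β) α β) (compositions≤ N)) (compositions≤ N))

⊗-normalForm : ∀ f g {N} → degree f ≤ N → degree g ≤ N →
  f ⊗ g T.≈ normalForm N (λ α β → coeff f α * coeff g β)
⊗-normalForm f g {N} f≤N g≤N = ≈-trans (⊗-cong (monomial-sum f f≤N) (λ _ → refl))
  (≈-trans (sumᵠ-⊗ (λ α → coeff f α QSymᴹ.*ₗ M α) (compositions≤ N) g)
  (concatMap-cong (compositions≤ N) λ α → ≈-trans
    (⊗-cong (λ _ → refl) (monomial-sum g g≤N))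
    (≈-trans (⊗-sumᵠ (coeff f α QSymᴹ.*ₗ M α) (λ β → coeff g β QSymᴹ.*ₗ M β) (compositions≤ N))
    (concatMap-cong (compositions≤ N) λ β → ≈-trans
      -- The scalar of the right factor moves to the left one, where the two scalars merge.
      (≈-sym (balanced (coeff g β) (coeff f α QSymᴹ.*ₗ M α) (M β)))
      (⊗-cong (λ a → trans (*-swap (coeff g β) (coeff f α) (coeff (M α) a))
                           (sym (ℚ.*-assoc (coeff f α) (coeff g β) (coeff (M α) a)))) (λ _ → refl))))))

tensorDegree : T.Carrier → ℕ
tensorDegree []            = 0
tensorDegree ((f , g) ∷ t) = (degree f ℕ.⊔ degree g) ℕ.⊔ tensorDegree t

≈-normalForm : ∀ t {N} → tensorDegree t ≤ N → t T.≈ normalForm N (bicoeff t)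
≈-normalForm [] {N} _ = ≈-sym (concatMap-[] (compositions≤ N) λ α → concatMap-[] (compositions≤ N) λ β →
  ≈-trans (⊗-cong (λ a → ℚ.*-zeroˡ (coeff (M α) a)) (λ _ → refl)) (zeroˡ (M β)))
≈-normalForm ((f , g) ∷ t) {N} deg≤N = ≈-trans
  (++-cong (⊗-normalForm f g
      (ℕ.≤-trans (ℕ.m≤m⊔n (degree f) (degree g)) fg≤N) (ℕ.≤-trans (ℕ.m≤n⊔m (degree f) (degree g)) fg≤N))
    (≈-normalForm t (ℕ.≤-trans (ℕ.m≤n⊔m (degree f ℕ.⊔ degree g) (tensorDegree t)) deg≤N)))
  (≈-sym (normalForm-+ N (λ α β → coeff f α * coeff g β) (bicoeff t)))
  where
  fg≤N : degree f ℕ.⊔ degree g ≤ N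
  fg≤N = ℕ.≤-trans (ℕ.m≤m⊔n (degree f ℕ.⊔ degree g) (tensorDegree t)) deg≤N

-- Both tensors are brought to normal form at the maximum of their degree bounds.
⊗-ext : ∀ s t → (∀ β γ → bicoeff s β γ ≡ bicoeff t β γ) → s T.≈ t
⊗-ext s t eq = ≈-trans (≈-normalForm s (ℕ.m≤m⊔n (tensorDegree s) (tensorDegree t)))
  (≈-trans (normalForm-cong (tensorDegree s ℕ.⊔ tensorDegree t) eq) (≈-sym (≈-normalForm t (ℕ.m≤n⊔m (tensorDegree s) (tensorDegree t)))))

-- Coproducts

nonzero-++ : ∀ β γ → nonzeroExponents (β ++ γ) ≡ nonzeroExponents β ++ nonzeroExponents γ
nonzero-++ []          γ = refl
nonzero-++ (zero  ∷ β) γ = nonzero-++ β γ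
nonzero-++ (suc n ∷ β) γ = cong (suc n ∷_) (nonzero-++ β γ)

-- At most one cut of `α` has left part `p`; the remaining condition is then that `r` is the rest.
splits-≟ : ∀ p r α →
  ∑ (splits α) (λ (u , v) → indicator (List.≡-dec ℕ._≟_ p u) * indicator (List.≡-dec ℕ._≟_ r v)) ≡
  indicator (List.≡-dec ℕ._≟_ (p ++ r) α)
splits-≟ [] r α = trans
  (∑-splits-null α (λ u v → indicator (List.≡-dec ℕ._≟_ [] u) * indicator (List.≡-dec ℕ._≟_ r v))
    (λ x u v → ℚ.*-zeroˡ (indicator (List.≡-dec ℕ._≟_ r v))))
  (ℚ.*-identityˡ (indicator (List.≡-dec ℕ._≟_ r α)))
splits-≟ (x ∷ p) r [] = trans (ℚ.+-identityʳ (0ℚ * indicator (List.≡-dec ℕ._≟_ r [])))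
  (ℚ.*-zeroˡ (indicator (List.≡-dec ℕ._≟_ r [])))
splits-≟ (x ∷ p) r (y ∷ α) = begin
  ∑ (splits (y ∷ α)) (λ (u , v) → f u v)
    ≡⟨ ∑-splits-∷ y α f ⟩
  0ℚ * indicator (List.≡-dec ℕ._≟_ r (y ∷ α)) + ∑ (splits α) (λ (u , v) → f (y ∷ u) v)
    ≡⟨ trans (cong (_+ rest) (ℚ.*-zeroˡ (indicator (List.≡-dec ℕ._≟_ r (y ∷ α))))) (ℚ.+-identityˡ rest) ⟩
  ∑ (splits α) (λ (u , v) → f (y ∷ u) v)
    ≡⟨ ∑-cong (splits α) (λ (u , v) → trans
         (cong (_* indicator (List.≡-dec ℕ._≟_ r v)) (⟦⟧-∧ (does (x ℕ.≟ y)) (does (List.≡-dec ℕ._≟_ p u))))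
         (ℚ.*-assoc ⟦ does (x ℕ.≟ y) ⟧ _ _)) ⟩
  ∑ (splits α) (λ (u , v) → ⟦ does (x ℕ.≟ y) ⟧ *
    (indicator (List.≡-dec ℕ._≟_ p u) * indicator (List.≡-dec ℕ._≟_ r v)))
    ≡⟨ *-∑ ⟦ does (x ℕ.≟ y) ⟧ (splits α) _ ⟨
  ⟦ does (x ℕ.≟ y) ⟧ * ∑ (splits α) (λ (u , v) →
    indicator (List.≡-dec ℕ._≟_ p u) * indicator (List.≡-dec ℕ._≟_ r v))
    ≡⟨ cong (⟦ does (x ℕ.≟ y) ⟧ *_) (splits-≟ p r α) ⟩
  ⟦ does (x ℕ.≟ y) ⟧ * indicator (List.≡-dec ℕ._≟_ (p ++ r) α)
    ≡⟨ ⟦⟧-∧ (does (x ℕ.≟ y)) (does (List.≡-dec ℕ._≟_ (p ++ r) α)) ⟨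
  indicator (List.≡-dec ℕ._≟_ (x ∷ p ++ r) (y ∷ α)) ∎
  where
  open ≡-Reasoning
  f : List ℕ → List ℕ → ℚ
  f u v = indicator (List.≡-dec ℕ._≟_ (x ∷ p) u) * indicator (List.≡-dec ℕ._≟_ r v)
  rest : ℚ
  rest = ∑ (splits α) (λ (u , v) → f (y ∷ u) v)

M-++ : ∀ α β γ → ∑ (splits α) (λ (u , v) → coeff (M u) β * coeff (M v) γ) ≡ coeff (M α) (β ++ γ)
M-++ α β γ = trans (splits-≟ (nonzeroExponents β) (nonzeroExponents γ) α)
  (cong (λ p → indicator (List.≡-dec ℕ._≟_ p α)) (sym (nonzero-++ β γ)))

∑-Δᵠ : ∀ f (h : QSymCarrier → QSymCarrier → ℚ) →
  ∑ (Δᵠ f) (λ (g , k) → h g k) ≡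
  ∑ (compositions≤ (degree f)) (λ α → ∑ (splits α) (λ (u , v) → h (coeff f α QSymᴹ.*ₗ M u) (M v)))
∑-Δᵠ f h = trans (∑-concatMap cuts (monomialExpansion f) {h′})
  (trans (∑-map (λ α → coeff f α , α) (compositions≤ (degree f)) {λ cα → ∑ (cuts cα) h′})
  (∑-cong (compositions≤ (degree f)) λ α → trans
    (∑-map (λ i → coeff f α QSymᴹ.*ₗ M (take i α) , M (drop i α)) (upTo (suc (length α))) {h′})
    (∑-take-drop α (λ u v → h (coeff f α QSymᴹ.*ₗ M u) (M v)))))
  where
  h′ : QSymCarrier × QSymCarrier → ℚ
  h′ (g , k) = h g k
  cuts : ℚ × List ℕ → T.Carrier
  cuts (c , α) = map (λ i → c QSymᴹ.*ₗ M (take i α) , M (drop i α)) (upTo (suc (length α)))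

bicoeff-Δᵠ : ∀ f β γ → bicoeff (Δᵠ f) β γ ≡ coeff f (β ++ γ)
bicoeff-Δᵠ f β γ = trans (∑-Δᵠ f (λ g k → coeff g β * coeff k γ))
  (trans (∑-cong (compositions≤ (degree f)) λ α → trans
    (∑-cong (splits α) λ (u , v) → ℚ.*-assoc (coeff f α) (coeff (M u) β) (coeff (M v) γ))
    (trans (sym (*-∑ (coeff f α) (splits α) _)) (cong (coeff f α *_) (M-++ α β γ))))
  (monomial-expansion f ℕ.≤-refl (β ++ γ)))

∑-Δᴴ : ∀ x (h : QSymCarrier → QSymCarrier → ℚ) →
  ∑ (map (Product.map Φ Φ) (Δᴴ x)) (λ (g , k) → h g k) ≡
  ∑ x (λ (q , π) → ∑ (upTo (suc ∣ π ∣)) (λ i → h (Φ (scaleᴴ q [ prefix i π ])) (Φ [ suffix i π ])))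
∑-Δᴴ x h = trans (∑-map (Product.map Φ Φ) (Δᴴ x))
  (trans (∑-concatMap cuts x {h′})
  (∑-cong x λ (q , π) → ∑-map (λ i → scaleᴴ q [ prefix i π ] , [ suffix i π ]) (upTo (suc ∣ π ∣)) {h′}))
  where
  h′ : HCarrier × HCarrier → ℚ
  h′ (y , z) = h (Φ y) (Φ z)
  cuts : ℚ × Perm → List (HCarrier × HCarrier)
  cuts (q , π) = map (λ i → scaleᴴ q [ prefix i π ] , [ suffix i π ]) (upTo (suc ∣ π ∣))

Φ-scale-[] : ∀ q π → Φ (scaleᴴ q [ π ]) QSymᴹ.≈ᴹ (q QSymᴹ.*ₗ F (Comp π))
Φ-scale-[] q π a = trans (Φ-scale q [ π ] a) (cong (q *_) (Φ-[] π a))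

Φ-Δ : ∀ x → map (Product.map Φ Φ) (Δᴴ x) T.≈ Δᵠ (Φ x)
Φ-Δ x = ⊗-ext (map (Product.map Φ Φ) (Δᴴ x)) (Δᵠ (Φ x)) λ β γ → begin
  bicoeff (map (Product.map Φ Φ) (Δᴴ x)) β γ
    ≡⟨ ∑-Δᴴ x (λ g k → coeff g β * coeff k γ) ⟩
  ∑ x (λ (q , π) → ∑ (upTo (suc ∣ π ∣)) (λ i → coeff (Φ (scaleᴴ q [ prefix i π ])) β * coeff (Φ [ suffix i π ]) γ))
    ≡⟨ ∑-cong x (λ (q , π) → trans
         (∑-cong (upTo (suc ∣ π ∣)) λ i → trans
           (cong₂ _*_
             (trans (Φ-scale-[] q (prefix i π) β) (cong (q *_) (coeff-F-Comp (prefix i π) β)))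
             (trans (Φ-[] (suffix i π) γ) (coeff-F-Comp (suffix i π) γ)))
           (ℚ.*-assoc q _ _))
         (trans (sym (*-∑ q (upTo (suc ∣ π ∣)) _))
         (cong (q *_) (trans (∑-take-drop (letters π) (λ u v → fundamental u β * fundamental v γ))
         (trans (fundamental-++ β γ (letters π)) (sym (coeff-F-Comp π (β ++ γ)))))))) ⟩
  ∑ x (λ (q , π) → q * coeff (F (Comp π)) (β ++ γ))
    ≡⟨ coeff-Φ x (β ++ γ) ⟨
  coeff (Φ x) (β ++ γ)
    ≡⟨ bicoeff-Δᵠ (Φ x) β γ ⟨
  bicoeff (Δᵠ (Φ x)) β γ ∎
  where open ≡-Reasoning

-- Antipodes

Sᵠ : QSymCarrier → QSymCarrier
Sᵠ = RawHopfAlgebra.S QSym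

antipodeM : List ℕ → QSymCarrier
antipodeM α = antipodeᵠ (length α) α

coeff-Sᵠ : ∀ f {N} → degree f ≤ N → ∀ a →
  coeff (Sᵠ f) a ≡ ∑ (compositions≤ N) (λ α → coeff f α * coeff (antipodeM α) a)
coeff-Sᵠ f {N} deg≤N a = trans
  (coeff-sumᵠ (λ (c , α) → c QSymᴹ.*ₗ antipodeM α) (monomialExpansion f) a)
  (trans (∑-map (λ α → coeff f α , α) (compositions≤ (degree f)) {λ (c , α) → c * coeff (antipodeM α) a})
         (sym (∑-compositions≤-stable f deg≤N (λ α → coeff (antipodeM α) a))))

-- Both sides are expanded up to the maximum of the two degree bounds, where they agree term by
-- term.
Sᵠ-cong : ∀ f g → f QSymᴹ.≈ᴹ g → Sᵠ f QSymᴹ.≈ᴹ Sᵠ g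
Sᵠ-cong f g f≈g a = trans (coeff-Sᵠ f (ℕ.m≤m⊔n (degree f) (degree g)) a)
  (trans (∑-cong (compositions≤ (degree f ℕ.⊔ degree g)) λ α → cong (_* coeff (antipodeM α) a) (f≈g α))
         (sym (coeff-Sᵠ g (ℕ.m≤n⊔m (degree f) (degree g)) a)))

Sᵠ-+ : ∀ f g → Sᵠ (f QSymᴹ.+ᴹ g) QSymᴹ.≈ᴹ (Sᵠ f QSymᴹ.+ᴹ Sᵠ g)
Sᵠ-+ f g a = trans (coeff-Sᵠ (f QSymᴹ.+ᴹ g) ℕ.≤-refl a)
  (trans (∑-cong (compositions≤ N) λ α → ℚ.*-distribʳ-+ (coeff (antipodeM α) a) (coeff f α) (coeff g α))
  (trans (∑-+ (compositions≤ N) (λ α → coeff f α * coeff (antipodeM α) a) (λ α → coeff g α * coeff (antipodeM α) a))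
  (sym (cong₂ _+_ (coeff-Sᵠ f (ℕ.m≤m⊔n (degree f) (degree g)) a) (coeff-Sᵠ g (ℕ.m≤n⊔m (degree f) (degree g)) a)))))
  where
  N : ℕ
  N = degree f ℕ.⊔ degree g

Sᵠ-scale : ∀ q f → Sᵠ (q QSymᴹ.*ₗ f) QSymᴹ.≈ᴹ (q QSymᴹ.*ₗ Sᵠ f)
Sᵠ-scale q f a = trans (coeff-Sᵠ (q QSymᴹ.*ₗ f) ℕ.≤-refl a)
  (trans (∑-cong (compositions≤ (degree f)) λ α → ℚ.*-assoc q (coeff f α) (coeff (antipodeM α) a))
  (trans (sym (*-∑ q (compositions≤ (degree f)) (λ α → coeff f α * coeff (antipodeM α) a)))
         (cong (q *_) (sym (coeff-Sᵠ f ℕ.≤-refl a)))))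

Sᵠ-0 : Sᵠ QSymᴹ.0ᴹ QSymᴹ.≈ᴹ QSymᴹ.0ᴹ
Sᵠ-0 a = trans (coeff-Sᵠ QSymᴹ.0ᴹ ℕ.≤-refl a)
  (trans (∑-cong (compositions≤ 0) λ α → ℚ.*-zeroˡ (coeff (antipodeM α) a)) (∑-0 (compositions≤ 0)))

δ-sym : ∀ s t → δ s t ≡ δ t s
δ-sym s t = cong ⟦_⟧ (does-⇔ (mk⇔ sym sym) (s ≟ˢ t) (t ≟ˢ s))

Sᵠ-M-comp : ∀ s → Sᵠ (M (comp s)) QSymᴹ.≈ᴹ antipodeM (comp s)
Sᵠ-M-comp s a = begin
  coeff (Sᵠ (M (comp s))) a
    ≡⟨ coeff-Sᵠ (M (comp s)) ℕ.≤-refl a ⟩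
  ∑ (compositions≤ N) (λ α → coeff (M (comp s)) α * coeff (antipodeM α) a)
    ≡⟨ ∑-compositions≤ N (λ α → coeff (M (comp s)) α * coeff (antipodeM α) a) ⟩
  ∑ (upTo (suc N)) (λ n → ∑ (shapes n) (λ t → coeff (M (comp s)) (comp t) * h t))
    ≡⟨ ∑-cong (upTo (suc N)) (λ n → trans
         (∑-cong (shapes n) λ t → trans (cong (_* h t) (trans (coeff-M s t) (δ-sym t s))) (ℚ.*-comm (δ s t) (h t)))
         (∑-shapes-δ n s h)) ⟩
  ∑ (upTo (suc N)) (λ n → ⟦ size s ≡ᵇ n ⟧ * h s)
    ≡⟨ ∑-* (upTo (suc N)) (λ n → ⟦ size s ≡ᵇ n ⟧) (h s) ⟨
  ∑ (upTo (suc N)) (λ n → ⟦ size s ≡ᵇ n ⟧) * h s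
    ≡⟨ cong (_* h s) (trans (∑-upTo-≡ᵇ (suc N) (size s))
         (cong ⟦_⟧ (<ᵇ-true (s≤s (ℕ.≤-reflexive (sym (sum-comp s))))))) ⟩
  1ℚ * h s
    ≡⟨ ℚ.*-identityˡ (h s) ⟩
  h s ∎
  where
  open ≡-Reasoning
  N : ℕ
  N = sum (comp s)
  h : Shape → ℚ
  h t = coeff (antipodeM (comp t)) a

nonzero-positive : ∀ a → All (0 <_) (nonzeroExponents a)
nonzero-positive []          = []
nonzero-positive (zero  ∷ a) = nonzero-positive a
nonzero-positive (suc n ∷ a) = s≤s z≤n ∷ nonzero-positive a

positive-nonzero : ∀ {a} → All (0 <_) a → nonzeroExponents a ≡ a
positive-nonzero []               = refl
positive-nonzero (s≤s z≤n ∷ 0<a) = cong (_ ∷_) (positive-nonzero 0<a)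

-- Positive entries make `α` the composition of a shape, hence one of the indices over which `Sᵠ`
-- expands.
Sᵠ-M : ∀ {α} → All (0 <_) α → Sᵠ (M α) QSymᴹ.≈ᴹ antipodeM α
Sᵠ-M {α} 0<α = subst (λ β → Sᵠ (M β) QSymᴹ.≈ᴹ antipodeM β)
  (trans (comp-shapeOf α) (positive-nonzero 0<α)) (Sᵠ-M-comp (shapeOf α))

compositions≤-positive : ∀ N → All (All (0 <_)) (compositions≤ N)
compositions≤-positive N = All.concat⁺ (All.map⁺ (All.universal
  (λ n → subst (All (All (0 <_))) (sym (compositions-shapes n)) (All.map⁺ (All.universal
    (λ s → subst (All (0 <_)) (nonzero-comp s) (nonzero-positive (comp s))) (shapes n))))
  (upTo (suc N))))

-- The constant series vanishes once an exponent is positive, so only the factorisation giving every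
-- exponent to `f` survives.
mulCoeff-1 : ∀ f a → mulCoeff f (coeff (M [])) a ≡ f a
mulCoeff-1 f []      = trans (ℚ.+-identityʳ (f [] * 1ℚ)) (ℚ.*-identityʳ (f []))
mulCoeff-1 f (n ∷ a) = begin
  mulCoeff f (coeff (M [])) (n ∷ a)
    ≡⟨ mulCoeff-∷ f (coeff (M [])) n a ⟩
  ∑ (upTo (suc n)) term
    ≡⟨ ∑-upTo-last n term ⟩
  ∑ (upTo n) term + term n
    ≡⟨ cong₂ _+_ (∑-zero (All.applyUpTo⁺₁ (λ i → i) n vanish)) last ⟩
  0ℚ + f (n ∷ a)
    ≡⟨ ℚ.+-identityˡ (f (n ∷ a)) ⟩
  f (n ∷ a) ∎
  where
  open ≡-Reasoning
  term : ℕ → ℚ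
  term i = mulCoeff (f ∘ (i ∷_)) (coeff (M []) ∘ ((n ℕ.∸ i) ∷_)) a
  last : term n ≡ f (n ∷ a)
  last = trans (cong (λ m → mulCoeff (f ∘ (n ∷_)) (coeff (M []) ∘ (m ∷_)) a) (ℕ.n∸n≡0 n))
    (mulCoeff-1 (f ∘ (n ∷_)) a)
  vanish : ∀ {i} → i < n → term i ≡ 0ℚ
  vanish {i} i<n with n ℕ.∸ i | ℕ.m<n⇒0<n∸m i<n
  ... | suc m | _ = trans (∑-cong (factorisations a) λ (b , c) → ℚ.*-zeroʳ (f (i ∷ b))) (∑-0 (factorisations a))

length-take-≤ : ∀ i (w : List A) → length (take i w) ≤ i
length-take-≤ i w = ℕ.≤-trans (ℕ.≤-reflexive (List.length-take i w)) (ℕ.m⊓n≤m i (length w))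

antipodeᵠ-∷ : ∀ k x α a → coeff (antipodeᵠ (suc k) (x ∷ α)) a ≡
  - ∑ (upTo (length (x ∷ α))) (λ i → mulCoeff (coeff (antipodeᵠ k (take i (x ∷ α)))) (coeff (M (drop i (x ∷ α)))) a)
antipodeᵠ-∷ k x α a = cong -_
  (coeff-sumᵠ (λ i → antipodeᵠ k (take i (x ∷ α)) *ᵠ M (drop i (x ∷ α))) (upTo (length (x ∷ α))) a)

-- The recursion hands the same fuel to all prefixes, whereas `antipodeM` uses the exact length;
-- this reconciles the two.
antipodeᵠ-fuel : ∀ k l α → length α ≤ k → length α ≤ l → antipodeᵠ k α QSymᴹ.≈ᴹ antipodeᵠ l α
antipodeᵠ-fuel k       l       []      _         _         a = refl
antipodeᵠ-fuel (suc k) (suc l) (x ∷ α) (s≤s α≤k) (s≤s α≤l) a = trans (antipodeᵠ-∷ k x α a)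
  (trans (cong -_ (∑-cong-All (All.applyUpTo⁺₁ (λ i → i) (suc (length α)) λ {i} i<n →
      mulCoeff-cong
        (antipodeᵠ-fuel k l (take i (x ∷ α)) (short i i<n α≤k) (short i i<n α≤l))
        (λ _ → refl) a)))
    (sym (antipodeᵠ-∷ l x α a)))
  where
  short : ∀ i {k} → i < suc (length α) → length α ≤ k → length (take i (x ∷ α)) ≤ k
  short i (s≤s i≤α) α≤k = ℕ.≤-trans (length-take-≤ i (x ∷ α)) (ℕ.≤-trans i≤α α≤k)

antipodeM-inverse : ∀ α a →
  ∑ (splits α) (λ (u , v) → mulCoeff (coeff (antipodeM u)) (coeff (M v)) a) ≡ ⟦ null α ⟧ * coeff (M []) a
antipodeM-inverse [] a = trans (ℚ.+-identityʳ _)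
  (trans (mulCoeff-1 (coeff (M [])) a) (sym (ℚ.*-identityˡ (coeff (M []) a))))
antipodeM-inverse α@(x ∷ α′) a = begin
  ∑ (splits α) (λ (u , v) → mulCoeff (coeff (antipodeM u)) (coeff (M v)) a)
    ≡⟨ ∑-take-drop α (λ u v → mulCoeff (coeff (antipodeM u)) (coeff (M v)) a) ⟨
  ∑ (upTo (suc n)) term
    ≡⟨ ∑-upTo-last n term ⟩
  ∑ (upTo n) term + term n
    -- The cut after the last part contributes `antipodeM α` itself, which the recursion defines as
    -- minus the sum over the earlier cuts.
    ≡⟨ cong (∑ (upTo n) term +_) (trans
         (cong₂ (λ u v → mulCoeff (coeff (antipodeM u)) (coeff (M v)) a)
           (List.take-all n α ℕ.≤-refl) (List.drop-all n α ℕ.≤-refl))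
         (trans (mulCoeff-1 (coeff (antipodeM α)) a)
         (trans (antipodeᵠ-∷ (length α′) x α′ a)
         (cong -_ (∑-cong-All (All.applyUpTo⁺₁ (λ i → i) n λ {i} i<n → mulCoeff-cong
           (antipodeᵠ-fuel (length α′) (length (take i α)) (take i α)
             (ℕ.≤-trans (length-take-≤ i α) (ℕ.s≤s⁻¹ i<n)) ℕ.≤-refl)
           (λ _ → refl) a)))))) ⟩
  ∑ (upTo n) term + - ∑ (upTo n) term
    ≡⟨ ℚ.+-inverseʳ (∑ (upTo n) term) ⟩
  0ℚ
    ≡⟨ ℚ.*-zeroˡ (coeff (M []) a) ⟨
  0ℚ * coeff (M []) a ∎
  where
  open ≡-Reasoning
  n : ℕ
  n = length α
  term : ℕ → ℚ
  term i = mulCoeff (coeff (antipodeM (take i α))) (coeff (M (drop i α))) a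

-- The coefficient of xᵃ in the image of t under multiplication ∘ (S ⊗ id).
convolve : Monomial → T.Carrier → ℚ
convolve a t = ∑ t λ (f , g) → mulCoeff (coeff (Sᵠ f)) (coeff g) a

mulCoeff-+ˡ : ∀ f f′ g a → mulCoeff (λ b → f b + f′ b) g a ≡ mulCoeff f g a + mulCoeff f′ g a
mulCoeff-+ˡ f f′ g a = trans
  (∑-cong (factorisations a) λ (b , c) → ℚ.*-distribʳ-+ (g c) (f b) (f′ b)) (∑-+ (factorisations a) _ _)

mulCoeff-+ʳ : ∀ f g g′ a → mulCoeff f (λ c → g c + g′ c) a ≡ mulCoeff f g a + mulCoeff f g′ a
mulCoeff-+ʳ f g g′ a = trans
  (∑-cong (factorisations a) λ (b , c) → ℚ.*-distribˡ-+ (f b) (g c) (g′ c)) (∑-+ (factorisations a) _ _)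

mulCoeff-scaleˡ : ∀ q f g a → mulCoeff (λ b → q * f b) g a ≡ q * mulCoeff f g a
mulCoeff-scaleˡ q f g a = trans
  (∑-cong (factorisations a) λ (b , c) → ℚ.*-assoc q (f b) (g c)) (sym (*-∑ q (factorisations a) _))

mulCoeff-scaleʳ : ∀ q f g a → mulCoeff f (λ c → q * g c) a ≡ q * mulCoeff f g a
mulCoeff-scaleʳ q f g a = trans
  (∑-cong (factorisations a) λ (b , c) → *-swap (f b) q (g c)) (sym (*-∑ q (factorisations a) _))

-- `Φ-Δ` equates coproducts only up to the tensor congruence, so `convolve` must be invariant under
-- each of its generators.
convolve-cong : ∀ a {s t} → s T.≈ t → convolve a s ≡ convolve a t
convolve-cong a T.≈-refl          = refl
convolve-cong a (T.≈-sym p)       = sym (convolve-cong a p)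
convolve-cong a (T.≈-trans p q)   = trans (convolve-cong a p) (convolve-cong a q)
convolve-cong a (T.++-cong {s} {s′} {t} {t′} p q) = trans (∑-++ s t)
  (trans (cong₂ _+_ (convolve-cong a p) (convolve-cong a q)) (sym (∑-++ s′ t′)))
convolve-cong a (T.++-comm s t)   = trans (∑-++ s t)
  (trans (ℚ.+-comm (convolve a s) (convolve a t)) (sym (∑-++ t s)))
convolve-cong a (T.⊗-cong {m} {m′} m≈ n≈) = cong (_+ 0ℚ) (mulCoeff-cong (Sᵠ-cong m m′ m≈) n≈ a)
convolve-cong a (T.distribʳ m m′ n) = trans
  (cong (_+ 0ℚ) (trans (mulCoeff-cong (Sᵠ-+ m m′) (λ _ → refl) a)
    (mulCoeff-+ˡ (coeff (Sᵠ m)) (coeff (Sᵠ m′)) (coeff n) a)))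
  (ℚ.+-assoc (mulCoeff (coeff (Sᵠ m)) (coeff n) a) (mulCoeff (coeff (Sᵠ m′)) (coeff n) a) 0ℚ)
convolve-cong a (T.distribˡ m n n′) = trans
  (cong (_+ 0ℚ) (mulCoeff-+ʳ (coeff (Sᵠ m)) (coeff n) (coeff n′) a))
  (ℚ.+-assoc (mulCoeff (coeff (Sᵠ m)) (coeff n) a) (mulCoeff (coeff (Sᵠ m)) (coeff n′) a) 0ℚ)
convolve-cong a (T.zeroˡ n) = cong (_+ 0ℚ) (trans (mulCoeff-cong Sᵠ-0 (λ _ → refl) a)
  (trans (∑-cong (factorisations a) λ (b , c) → ℚ.*-zeroˡ (coeff n c)) (∑-0 (factorisations a))))
convolve-cong a (T.zeroʳ m) = cong (_+ 0ℚ)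
  (trans (∑-cong (factorisations a) λ (b , c) → ℚ.*-zeroʳ (coeff (Sᵠ m) b)) (∑-0 (factorisations a)))
convolve-cong a (T.balanced q m n) = cong (_+ 0ℚ) (trans (mulCoeff-cong (Sᵠ-scale q m) (λ _ → refl) a)
  (trans (mulCoeff-scaleˡ q (coeff (Sᵠ m)) (coeff n) a) (sym (mulCoeff-scaleʳ q (coeff (Sᵠ m)) (coeff n) a))))

convolve-Δᵠ : ∀ f a → convolve a (Δᵠ f) ≡ coeff f [] * coeff (M []) a
convolve-Δᵠ f a = begin
  convolve a (Δᵠ f)
    ≡⟨ ∑-Δᵠ f (λ g k → mulCoeff (coeff (Sᵠ g)) (coeff k) a) ⟩
  ∑ cs (λ α → ∑ (splits α) (λ (u , v) → mulCoeff (coeff (Sᵠ (coeff f α QSymᴹ.*ₗ M u))) (coeff (M v)) a))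
    ≡⟨ ∑-cong-All (All.map (λ {α} 0<α → trans
         (∑-cong-All (All.map (λ {(u , v)} u++v≡α → trans
           (mulCoeff-cong
             (λ b → trans (Sᵠ-scale (coeff f α) (M u) b)
               -- The prefix `u` inherits positive entries from `α`, as `Sᵠ-M` requires.
               (cong (coeff f α *_) (Sᵠ-M (All.++⁻ˡ u (subst (All (0 <_)) (sym u++v≡α) 0<α)) b)))
             (λ _ → refl) a)
           (mulCoeff-scaleˡ (coeff f α) (coeff (antipodeM u)) (coeff (M v)) a)) (splits-++ α)))
         (trans (sym (*-∑ (coeff f α) (splits α) _)) (cong (coeff f α *_) (antipodeM-inverse α a))))
         (compositions≤-positive (degree f))) ⟩
  ∑ cs (λ α → coeff f α * (⟦ null α ⟧ * coeff (M []) a))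
    ≡⟨ ∑-cong cs (λ α → trans (cong (λ p → coeff f α * (p * coeff (M []) a)) (null-M α))
         (sym (ℚ.*-assoc (coeff f α) (coeff (M α) []) (coeff (M []) a)))) ⟩
  ∑ cs (λ α → coeff f α * coeff (M α) [] * coeff (M []) a)
    ≡⟨ ∑-* cs (λ α → coeff f α * coeff (M α) []) (coeff (M []) a) ⟨
  ∑ cs (λ α → coeff f α * coeff (M α) []) * coeff (M []) a
    ≡⟨ cong (_* coeff (M []) a) (monomial-expansion f ℕ.≤-refl []) ⟩
  coeff f [] * coeff (M []) a ∎
  where
  open ≡-Reasoning
  cs : List (List ℕ)
  cs = compositions≤ (degree f)
  null-M : ∀ α → ⟦ null α ⟧ ≡ coeff (M α) []
  null-M []      = refl
  null-M (_ ∷ _) = refl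

-- The antipode axiom for `Φ [ π ]` in QSym, with its coproduct rewritten by `Φ-Δ` as cuts of the
-- permutation.
F-antipode-inverse : ∀ π a →
  ∑ (upTo (suc ∣ π ∣)) (λ i → mulCoeff (coeff (Sᵠ (F (Comp (prefix i π))))) (coeff (F (Comp (suffix i π)))) a) ≡
  ⟦ null (letters π) ⟧ * coeff (M []) a
F-antipode-inverse π a = begin
  ∑ (upTo (suc ∣ π ∣)) (λ i → mulCoeff (coeff (Sᵠ (F (Comp (prefix i π))))) (coeff (F (Comp (suffix i π)))) a)
    ≡⟨ ∑-cong (upTo (suc ∣ π ∣)) (λ i → mulCoeff-cong
         -- `Δᴴ` places the coefficient of a term, here `1ℚ`, on the left tensor factor.
         (Sᵠ-cong (Φ (scaleᴴ 1ℚ [ prefix i π ])) (F (Comp (prefix i π)))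
           (λ b → trans (Φ-scale-[] 1ℚ (prefix i π) b) (ℚ.*-identityˡ _)))
         (Φ-[] (suffix i π)) a) ⟨
  ∑ (upTo (suc ∣ π ∣)) (λ i → mulCoeff (coeff (Sᵠ (Φ (scaleᴴ 1ℚ [ prefix i π ])))) (coeff (Φ [ suffix i π ])) a)
    ≡⟨ trans (∑-Δᴴ [ π ] (λ g k → mulCoeff (coeff (Sᵠ g)) (coeff k) a)) (ℚ.+-identityʳ _) ⟨
  convolve a (map (Product.map Φ Φ) (Δᴴ [ π ]))
    ≡⟨ convolve-cong a (Φ-Δ [ π ]) ⟩
  convolve a (Δᵠ (Φ [ π ]))
    ≡⟨ convolve-Δᵠ (Φ [ π ]) a ⟩
  coeff (Φ [ π ]) [] * coeff (M []) a
    ≡⟨ cong (_* coeff (M []) a) (trans (Φ-[] π []) (coeff-F-Comp π [])) ⟩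
  ⟦ null (letters π) ⟧ * coeff (M []) a ∎
  where open ≡-Reasoning

-- Avoids an equality of permutations, which would also compare the proofs of positivity and
-- distinctness.
letters⇒Comp : ∀ π σ → letters π ≡ letters σ → Comp π ≡ Comp σ
letters⇒Comp π σ eq = trans (Comp-descents π) (trans (cong (comp ∘ descents) eq) (sym (Comp-descents σ)))

F-∅ : F [] QSymᴹ.≈ᴹ M []
F-∅ a = trans (sym (Φ-[] ∅ a)) (Φ-1 a)

Sᵠ-F-last : ∀ π a →
  mulCoeff (coeff (Sᵠ (F (Comp (prefix ∣ π ∣ π))))) (coeff (F (Comp (suffix ∣ π ∣ π)))) a ≡ coeff (Sᵠ (F (Comp π))) a
Sᵠ-F-last π a = trans
  (mulCoeff-cong
    (λ b → cong (λ α → coeff (Sᵠ (F α)) b)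
      (letters⇒Comp (prefix ∣ π ∣ π) π (List.take-all ∣ π ∣ (letters π) ℕ.≤-refl)))
    (λ c → trans (cong (λ α → coeff (F α) c)
        (letters⇒Comp (suffix ∣ π ∣ π) ∅ (List.drop-all ∣ π ∣ (letters π) ℕ.≤-refl))) (F-∅ c)) a)
  (mulCoeff-1 (coeff (Sᵠ (F (Comp π)))) a)

module _ (reps : Representatives) where

  -- The inverse identity for F, solved for the term of the full prefix, is the recursion defining
  -- `antipodeᴴ`; proper prefixes are covered by induction on the fuel.
  Φ-antipodeᴴ : ∀ k π → ∣ π ∣ ≤ k → Φ (antipodeᴴ reps k π) QSymᴹ.≈ᴹ Sᵠ (F (Comp π))
  -- For the empty word the inverse identity has a single term, and it says that `Sᵠ (F [])` is
  -- `M []`.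
  Φ-antipodeᴴ k π@(perm [] [] []) _ a = trans (Φ-1 a) (sym (trans (sym (Sᵠ-F-last π a))
    (trans (sym (ℚ.+-identityʳ _)) (trans (F-antipode-inverse π a) (ℚ.*-identityˡ (coeff (M []) a))))))
  Φ-antipodeᴴ (suc k) π@(perm (x ∷ w) _ _) (s≤s n≤k) a = begin
    coeff (Φ (-ᴴ concatMap mul (upTo n))) a
      ≡⟨ Φ-neg (concatMap mul (upTo n)) a ⟩
    - coeff (Φ (concatMap mul (upTo n))) a
      ≡⟨ cong -_ (trans (coeff-Φ (concatMap mul (upTo n)) a) (trans
           (∑-concatMap mul (upTo n) {λ (q , π) → q * coeff (F (Comp π)) a})
           (∑-cong (upTo n) λ i → sym (coeff-Φ (mul i) a)))) ⟩
    - ∑ (upTo n) (λ i → coeff (Φ (mul i)) a)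
      ≡⟨ cong -_ (∑-cong-All (All.applyUpTo⁺₁ (λ i → i) n λ {i} i<n → trans
           (Φ-* reps (antipodeᴴ reps k (prefix i π)) [ suffix i π ] a)
           (mulCoeff-cong
             (Φ-antipodeᴴ k (prefix i π) (ℕ.≤-trans (length-take-≤ i (x ∷ w)) (ℕ.≤-trans (ℕ.s≤s⁻¹ i<n) n≤k)))
             (Φ-[] (suffix i π)) a))) ⟩
    - ∑ (upTo n) term
      ≡⟨ ℚ.+-identityˡ (- ∑ (upTo n) term) ⟨
    0ℚ + - ∑ (upTo n) term
      -- Zero is replaced by the sum over all cuts, which vanishes because the word is nonempty; its
      -- last term is `Sπ`.
      ≡⟨ cong (_+ - ∑ (upTo n) term) (trans (sym (ℚ.*-zeroˡ (coeff (M []) a)))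
           (trans (sym (F-antipode-inverse π a)) (trans (∑-upTo-last n term)
           (trans (cong (∑ (upTo n) term +_) (Sᵠ-F-last π a)) (ℚ.+-comm (∑ (upTo n) term) Sπ))))) ⟩
    (Sπ + ∑ (upTo n) term) + - ∑ (upTo n) term
      ≡⟨ ℚ.+-assoc Sπ (∑ (upTo n) term) (- ∑ (upTo n) term) ⟩
    Sπ + (∑ (upTo n) term + - ∑ (upTo n) term)
      ≡⟨ trans (cong (Sπ +_) (ℚ.+-inverseʳ (∑ (upTo n) term))) (ℚ.+-identityʳ Sπ) ⟩
    Sπ ∎
    where
    open ≡-Reasoning
    n : ℕ
    n = ∣ π ∣
    mul : ℕ → HCarrier
    mul i = mulᴴ reps (antipodeᴴ reps k (prefix i π)) [ suffix i π ]
    term : ℕ → ℚ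
    term i = mulCoeff (coeff (Sᵠ (F (Comp (prefix i π))))) (coeff (F (Comp (suffix i π)))) a
    Sπ : ℚ
    Sπ = coeff (Sᵠ (F (Comp π))) a

  Φ-S : ∀ x → Φ (RawHopfAlgebra.S (H-Des reps) x) QSymᴹ.≈ᴹ Sᵠ (Φ x)
  Φ-S []            a = sym (Sᵠ-0 a)
  Φ-S ((q , π) ∷ x) a = begin
    coeff (Φ (scaleᴴ q (antipodeᴴ reps ∣ π ∣ π) ++ Sᴴ x)) a
      ≡⟨ Φ-++ (scaleᴴ q (antipodeᴴ reps ∣ π ∣ π)) (Sᴴ x) a ⟩
    coeff (Φ (scaleᴴ q (antipodeᴴ reps ∣ π ∣ π))) a + coeff (Φ (Sᴴ x)) a
      ≡⟨ cong₂ _+_ (trans (Φ-scale q (antipodeᴴ reps ∣ π ∣ π) a)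
           (trans (cong (q *_) (Φ-antipodeᴴ ∣ π ∣ π ℕ.≤-refl a)) (sym (Sᵠ-scale q (F (Comp π)) a)))) (Φ-S x a) ⟩
    coeff (Sᵠ (q QSymᴹ.*ₗ F (Comp π))) a + coeff (Sᵠ (Φ x)) a
      ≡⟨ Sᵠ-+ (q QSymᴹ.*ₗ F (Comp π)) (Φ x) a ⟨
    coeff (Sᵠ (Φ ((q , π) ∷ x))) a ∎
    where
    open ≡-Reasoning
    Sᴴ : HCarrier → HCarrier
    Sᴴ = RawHopfAlgebra.S (H-Des reps)

proposition3p18 : (reps : Representatives) → IsHopfAlgebraIsomorphism (H-Des reps) QSym Φ
proposition3p18 reps = record
  { isLeftModuleIsomorphism = Φ-isLeftModuleIsomorphism
  ; *-homo = Φ-* reps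
  ; 1-homo = Φ-1
  ; Δ-homo = Φ-Δ
  ; ε-homo = Φ-ε
  ; S-homo = Φ-S reps
  }
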